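{- Let $x$ be an involution in $S_n$. Then $\mathcal{A}(x)^{ -1}=\{u\in S_n:\hat0(x)\preceq_{\mathcal{A}}u\}=\{u\in S_n:u\preceq_{\mathcal{A}}\hat1(x)\}$.
   Context: $S_n$ is the Coxeter group with simple generators $s_i=(i,i+1)$ and length $\ell$; permutations are identified with one-line sequences $[w(1),\dots,w(n)]$. The Demazure product $\circ$ is the unique associative operation on $S_n$ with $s\circ w = sw$ if $\ell(sw)>\ell(w)$ and $s\circ w=w$ otherwise, and $w\circ s=ws$ if $\ell(ws)>\ell(w)$ and $w\circ s = w$ otherwise. $\mathcal{A}(x)$ is the set of minimal-length $w\in S_n$ with $w^{ -1}\circ w=x$, and $\mathcal{A}(x)^{ -1}=\{u^{ -1}:u\in\mathcal{A}(x)\}$. $\prec_{\mathcal{A}}$ is the transitive closure of the relation on integer sequences with $[\cdots,c,a,b,\cdots]\prec_{\mathcal{A}}[\cdots,b,c,a,\cdots]$ when $a\le b\le c$ (same consecutive positions, other entries equal); $\preceq_{\mathcal{A}}$ means $\prec_{\mathcal{A}}$ or equal. Let $\mathrm{Cyc}(x)=\{(a,b):a\le b=x(a)\}$, of size $k$; list it as $(a_1,b_1),\dots,(a_k,b_k)$ with $a_1<\dots<a_k$ and as $(c_1,d_1),\dots,(c_k,d_k)$ with $d_1<\dots<d_k$. For a list $L$, $[[L]]$ is $L$ with repeated entries deleted after their first occurrence. Then $\hat0(x)=[[b_1,a_1,b_2,a_2,\dots,b_k,a_k]]$ and $\hat1(x)=[[d_1,c_1,\dots,d_k,c_k]]$,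 regarded as permutations in one-line notation. -}

module Defs where

open import Data.Nat using (ℕ; zero; suc; _≤_; _<ᵇ_; _≤ᵇ_; _≡ᵇ_; _+_; _∸_)
open import Data.Nat.Properties using (_≟_)
open import Data.Bool using (Bool; true; false; if_then_else_)
open import Data.List using (List; []; _∷_; _++_; map; upTo; foldl; concatMap; length; deduplicate)
open import Data.Maybe using (Maybe; just; nothing)
import Data.Maybe
open import Data.Product using (_×_; _,_; ∃)
open import Data.Sum using (_⊎_)
open import Data.List.Relation.Binary.Permutation.Propositional using (_↭_)
open import Relation.Binary.PropositionalEquality using (_≡_)
open import Relation.Binary.Construct.Closure.Transitive using (Plus)

-- Permutations of [n] = {1,…,n} are one-line lists [w(1),…,w(n)].

range : ℕ → List ℕ
range n = map suc (upTo n)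

IsPerm : ℕ → List ℕ → Set
IsPerm n w = w ↭ range n

-- w(j), 1-indexed (junk value 0 outside the domain)
at : List ℕ → ℕ → ℕ
at []       _             = 0
at (x ∷ xs) zero          = 0
at (x ∷ xs) (suc zero)    = x
at (x ∷ xs) (suc (suc k)) = at xs (suc k)

compose : List ℕ → List ℕ → List ℕ
compose u w = map (at u) w

pos : ℕ → List ℕ → ℕ
pos i []       = 0
pos i (x ∷ xs) = if i ≡ᵇ x then 1 else suc (pos i xs)

inv : ℕ → List ℕ → List ℕ
inv n w = map (λ i → pos i w) (range n)

swapAt : ℕ → List ℕ → List ℕ
swapAt (suc zero)    (x ∷ y ∷ r) = y ∷ x ∷ r
swapAt (suc (suc k)) (x ∷ r)     = x ∷ swapAt (suc k) r
swapAt _             w           = w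

-- Coxeter length = number of inversions
countLess : ℕ → List ℕ → ℕ
countLess x []       = 0
countLess x (y ∷ ys) = (if y <ᵇ x then 1 else 0) + countLess x ys

ℓ : List ℕ → ℕ
ℓ []       = 0
ℓ (x ∷ xs) = countLess x xs + ℓ xs

demS : List ℕ → ℕ → List ℕ
demS w i = if ℓ w <ᵇ ℓ (swapAt i w) then swapAt i w else w

firstDesc : List ℕ → Maybe ℕ
firstDesc []      = nothing
firstDesc (x ∷ r) = go x r
  where
  go : ℕ → List ℕ → Maybe ℕ
  go x []      = nothing
  go x (y ∷ r) = if y <ᵇ x then just 1 else Data.Maybe.map suc (go y r)

-- a reduced word [i₁,…,i_k] of v, i.e. v = s_{i₁} ⋯ s_{i_k} with k = ℓ(v)
-- (fuel = ℓ(v); each step strips a right descent)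
redWordF : ℕ → List ℕ → List ℕ
redWordF zero    v = []
redWordF (suc f) v with firstDesc v
... | nothing = []
... | just i  = redWordF f (swapAt i v) ++ (i ∷ [])

redWord : List ℕ → List ℕ
redWord v = redWordF (ℓ v) v

-- Demazure product  w ∘ v = (⋯((w ∘ s_{i₁}) ∘ s_{i₂}) ⋯) ∘ s_{i_k}
_○_ : List ℕ → List ℕ → List ℕ
w ○ v = foldl demS w (redWord v)

IsInvolution : ℕ → List ℕ → Set
IsInvolution n x = IsPerm n x × compose x x ≡ range n

InA : ℕ → List ℕ → List ℕ → Set
InA n x w = IsPerm n w × (inv n w ○ w ≡ x)
          × (∀ w′ → IsPerm n w′ → inv n w′ ○ w′ ≡ x → ℓ w ≤ ℓ w′)

InAinv : ℕ → List ℕ → List ℕ → Set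
InAinv n x u = ∃ λ w → InA n x w × u ≡ inv n w

cycByA : ℕ → List ℕ → List (ℕ × ℕ)
cycByA n x = concatMap (λ a → if a ≤ᵇ at x a then (a , at x a) ∷ [] else []) (range n)

-- Cyc(x) listed by increasing d: pairs (c, d) with c ≤ d = x(c), i.e. c = x(d)
cycByD : ℕ → List ℕ → List (ℕ × ℕ)
cycByD n x = concatMap (λ d → if at x d ≤ᵇ d then (at x d , d) ∷ [] else []) (range n)

dedup : List ℕ → List ℕ
dedup = deduplicate _≟_

flipPairs : List (ℕ × ℕ) → List ℕ
flipPairs = concatMap (λ { (a , b) → b ∷ a ∷ [] })

hat0 : ℕ → List ℕ → List ℕ
hat0 n x = dedup (flipPairs (cycByA n x))

hat1 : ℕ → List ℕ → List ℕ
hat1 n x = dedup (flipPairs (cycByD n x))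

data StepA : List ℕ → List ℕ → Set where
  step : ∀ p q a b c → a ≤ b → b ≤ c →
         StepA (p ++ c ∷ a ∷ b ∷ q) (p ++ b ∷ c ∷ a ∷ q)

_≺A_ : List ℕ → List ℕ → Set
_≺A_ = Plus StepA

_⪯A_ : List ℕ → List ℕ → Set
u ⪯A v = u ≺A v ⊎ u ≡ v

-- Let q a be the position of a in u. The heart of the matter is a local description (the record
-- Atom) of the u in A(x)⁻¹: in u, the larger element of a 2-cycle precedes the smaller one with no
-- intermediate value between them, and a cycle lying to the left of another one (both its minimum
-- and its maximum are smaller) comes first.
-- Stripping a left descent i off u turns x into a y with x = s_i ∘ y ∘ s_i, and Atom is
-- compatible with this operation, so by induction on length Atom X q characterises the shortest
-- solutions. It also forces every descent of u to be a 2-cycle of x; hence it is invariant under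
-- c a b → b c a, and an atom without consecutive pattern b c a (resp. c a b) must list the
-- cycles by increasing minimum (resp. maximum), that is, must be 0̂(x) (resp. 1̂(x)).

module Submission where

open import Defs
open import Data.Bool using (Bool; true; false; if_then_else_; T)
open import Data.Empty using (⊥; ⊥-elim)
open import Data.List using (List; []; _∷_; _++_; map; upTo; applyUpTo; foldl; length; filter; concatMap)
open import Data.List.Properties using (length-map; length-upTo; length-++; foldl-++; map-id; filter-accept; filter-reject)
open import Data.List.Membership.Propositional using (_∈_; _∉_)
open import Data.List.Membership.Propositional.Properties
  using (∈-map⁺; ∈-map⁻; ∈-upTo⁺; ∈-upTo⁻; ∈-deduplicate⁺; ∈-deduplicate⁻)
open import Data.List.Membership.Propositional.Properties.WithK using (unique∧set⇒bag)
open import Data.List.Relation.Binary.BagAndSetEquality using (∼bag⇒↭)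
open import Data.List.Relation.Binary.Permutation.Propositional
  using (_↭_; ↭-refl; ↭-sym; ↭-trans; ↭-reflexive; ↭⇒↭ₛ; prep; swap)
import Data.List.Relation.Binary.Permutation.Propositional.Properties as ↭
import Data.List.Relation.Binary.Permutation.Setoid.Properties as ↭ₛ
open import Data.List.Relation.Binary.Pointwise using (Pointwise-≡⇒≡)
open import Data.List.Relation.Unary.All as All using (All; []; _∷_)
import Data.List.Relation.Unary.All.Properties as All
open import Data.List.Relation.Unary.AllPairs using (AllPairs; []; _∷_)
import Data.List.Relation.Unary.AllPairs.Properties as AllPairs
open import Data.List.Relation.Unary.Any using (here; there)
open import Data.List.Relation.Unary.Linked using (Linked; []; [-]; _∷_)
import Data.List.Relation.Unary.Linked.Properties as Linked
open import Data.List.Relation.Unary.Sorted.TotalOrder.Properties using (↗↭↗⇒≋)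
open import Data.List.Relation.Unary.Unique.Propositional using (Unique)
import Data.List.Relation.Unary.Unique.Propositional.Properties as Unique
open import Data.Maybe as Maybe using (just; nothing)
open import Data.Nat
open import Data.Nat.Induction using (<-wellFounded)
open import Data.Nat.ListAction using (sum)
open import Data.Nat.ListAction.Properties using (sum-↭)
open import Data.Nat.Properties
open import Data.Nat.Solver using (module +-*-Solver)
open import Data.List.Relation.Unary.Unique.DecPropositional.Properties _≟_ using (deduplicate-!)
open import Data.Product using (_×_; _,_; proj₁; proj₂; ∃; ∃₂)
open import Data.Sum using (_⊎_; inj₁; inj₂; [_,_]′)
open import Data.Unit using (tt)
open import Function using (_∘_; id)
open import Function.Bundles using (_⇔_; mk⇔; Equivalence)
open import Function.Construct.Composition using (_⇔-∘_)
open import Induction.WellFounded using (Acc; acc)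
open import Relation.Binary using (tri<; tri≈; tri>)
open import Relation.Binary.Construct.Closure.Transitive using ([_]; _∼⁺⟨_⟩_)
open import Relation.Binary.PropositionalEquality hiding ([_])
open import Relation.Nullary using (¬_; ¬?; yes; no)
open import Relation.Nullary.Decidable using (_×-dec_)

-- Atoms and conjugation by a simple reflection

-- The function q is at once the position function of u and the one-line function of w = u⁻¹, so a
-- left descent i of u reads q (i + 1) < q i. All permutations are extended by the identity to ℕ;
-- bounds appear only when a statement returns to lists. Minimality of length is never estimated
-- directly. Replaying the recursion for w⁻¹ ∘ w on a second word, and omitting every letter that
-- leaves the product unchanged, produces an atom that is w itself or strictly shorter. On the other
-- hand, all atoms are joined to 0̂(x) by steps, and a step c a b → b c a keeps the length because
-- both of its ends lie one below the same word c b a. So all atoms have one common length, and it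
-- is the least one. The Demazure product enters through s_i ∘ y ∘ s_i, which rests on the
-- commutation of left with right multiplication by generators.

sw : ℕ → ℕ → ℕ
sw zero    zero          = 1
sw zero    (suc zero)    = 0
sw zero    (suc (suc a)) = suc (suc a)
sw (suc i) zero          = 0
sw (suc i) (suc a)       = suc (sw i a)

sw-involutive : ∀ i a → sw i (sw i a) ≡ a
sw-involutive zero    zero          = refl
sw-involutive zero    (suc zero)    = refl
sw-involutive zero    (suc (suc a)) = refl
sw-involutive (suc i) zero          = refl
sw-involutive (suc i) (suc a)       = cong suc (sw-involutive i a)

sw-left : ∀ i → sw i i ≡ suc i
sw-left zero    = refl
sw-left (suc i) = cong suc (sw-left i)

sw-right : ∀ i → sw i (suc i) ≡ i
sw-right zero    = refl
sw-right (suc i) = cong suc (sw-right i)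

sw-other : ∀ i {a} → a ≢ i → a ≢ suc i → sw i a ≡ a
sw-other zero    {zero}        p q = ⊥-elim (p refl)
sw-other zero    {suc zero}    p q = ⊥-elim (q refl)
sw-other zero    {suc (suc a)} p q = refl
sw-other (suc i) {zero}        p q = refl
sw-other (suc i) {suc a}       p q = cong suc (sw-other i (p ∘ cong suc) (q ∘ cong suc))

data SwView (i : ℕ) : ℕ → Set where
  left  : SwView i i
  right : SwView i (suc i)
  other : ∀ {a} → a ≢ i → a ≢ suc i → SwView i a

swView : ∀ i a → SwView i a
swView i a with a ≟ i | a ≟ suc i
... | yes refl | _        = left
... | no _     | yes refl = right
... | no p     | no q     = other p q

-- No integer lies strictly between i and i + 1, so a single pair changes its order. This
-- exceptional alternative is the source of the special cases in the conjugation lemmas.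
sw-< : ∀ i {a b} → a < b → sw i a < sw i b ⊎ (a ≡ i × b ≡ suc i)
sw-< zero    {zero}        {suc zero}    _  = inj₂ (refl , refl)
sw-< zero    {zero}        {suc (suc b)} _  = inj₁ (s≤s (s≤s z≤n))
sw-< zero    {suc zero}    {suc (suc b)} _  = inj₁ (s≤s z≤n)
sw-< zero    {suc zero}    {suc zero} (s≤s ())
sw-< zero    {suc (suc a)} {suc zero} (s≤s ())
sw-< zero    {suc (suc a)} {suc (suc b)} lt = inj₁ lt
sw-< (suc i) {zero}        {suc b}       _  = inj₁ (s≤s z≤n)
sw-< (suc i) {suc a}       {suc b} (s≤s lt) with sw-< i lt
... | inj₁ l             = inj₁ (s≤s l)
... | inj₂ (refl , refl) = inj₂ (refl , refl)

sw-injective : ∀ i {a b} → sw i a ≡ sw i b → a ≡ b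
sw-injective i {a} {b} e =
  trans (sym (sw-involutive i a)) (trans (cong (sw i) e) (sw-involutive i b))

sw-<⁻ : ∀ i {a b} → sw i a < sw i b → a < b ⊎ (a ≡ suc i × b ≡ i)
sw-<⁻ i {a} {b} lt with sw-< i lt
... | inj₁ l = inj₁ (subst₂ _<_ (sw-involutive i a) (sw-involutive i b) l)
... | inj₂ (p , q) =
  inj₂ ( sw-injective i (trans p (sym (sw-right i)))
       , sw-injective i (trans q (sym (sw-left i))))

sw-≤⁻ : ∀ i {a b} → sw i a ≤ sw i b → a ≤ b ⊎ (a ≡ suc i × b ≡ i)
sw-≤⁻ i le with m≤n⇒m<n∨m≡n le
... | inj₂ e = inj₁ (≤-reflexive (sw-injective i e))
... | inj₁ lt with sw-<⁻ i lt
...   | inj₁ l = inj₁ (<⇒≤ l)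
...   | inj₂ r = inj₂ r

Involutive : (ℕ → ℕ) → Set
Involutive X = ∀ a → X (X a) ≡ a

Injective : (ℕ → ℕ) → Set
Injective q = ∀ {a b} → q a ≡ q b → a ≡ b

involutive⇒injective : ∀ {X} → Involutive X → Injective X
involutive⇒injective {X} inv {a} {b} e = trans (sym (inv a)) (trans (cong X e) (inv b))

-- `ordered` makes only one comparison: by `upperFirst`, the minimum a is the last entry of its
-- cycle and the maximum `X b` the first entry of its own. Fixed points count as cycles, hence `≤`.
record Atom (X q : ℕ → ℕ) : Set where
  field
    upperFirst : ∀ {a} → a < X a → q (X a) < q a
    noneInside : ∀ {a e} → a < e → e < X a → q (X a) < q e → q a < q e
    ordered    : ∀ {a b} → a ≤ X a → b ≤ X b → a < b → X a < X b → q a < q (X b)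

open Atom

atom-cong : ∀ {X Y q r} → (∀ a → X a ≡ Y a) → (∀ a → q a ≡ r a) → Atom X q → Atom Y r
atom-cong {X} {Y} {q} {r} XY qr A = record
  { upperFirst = λ {a} lt → rX a (upperFirst A (subst (a <_) (sym (XY a)) lt))
  ; noneInside = λ {a} {e} l₁ l₂ l₃ → subst₂ _<_ (qr a) (qr e)
      (noneInside A l₁ (subst (e <_) (sym (XY a)) l₂)
        (subst₂ _<_ (sym (trans (cong q (XY a)) (qr (Y a)))) (sym (qr e)) l₃))
  ; ordered = λ {a} {b} l₁ l₂ l₃ l₄ → subst₂ _<_ (qr a) (trans (cong q (XY b)) (qr (Y b)))
      (ordered A (subst (a ≤_) (sym (XY a)) l₁) (subst (b ≤_) (sym (XY b)) l₂) l₃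
        (subst₂ _<_ (sym (XY a)) (sym (XY b)) l₄))
  }
  where
  rX : ∀ a → q (X a) < q a → r (Y a) < r a
  rX a = subst₂ _<_ (trans (cong q (XY a)) (qr (Y a))) (qr a)

-- Symmetric in the two elements of each cycle: exchanging a with `X a`, or b with `X b`, merely
-- permutes the fields, so a convenient representative can be chosen.
record Before (X q : ℕ → ℕ) (a b : ℕ) : Set where
  constructor before
  field
    b₁ : q a < q b
    b₂ : q (X a) < q b
    b₃ : q a < q (X b)
    b₄ : q (X a) < q (X b)

open Before

before-Xˡ : ∀ {X q} → Involutive X → ∀ {a b} → Before X q (X a) b → Before X q a b
before-Xˡ {X} {q} inv {a} {b} (before p₁ p₂ p₃ p₄) =
  before (subst (λ z → q z < q b) (inv a) p₂) p₁ (subst (λ z → q z < q (X b)) (inv a) p₄) p₃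

before-Xʳ : ∀ {X q} → Involutive X → ∀ {a b} → Before X q a (X b) → Before X q a b
before-Xʳ {X} {q} inv {a} {b} (before p₁ p₂ p₃ p₄) =
  before (subst (λ z → q a < q z) (inv b) p₃) (subst (λ z → q (X a) < q z) (inv b) p₄) p₁ p₂

upperFirst≤ : ∀ {X q : ℕ → ℕ} → (∀ {a} → a < X a → q (X a) < q a) → ∀ {a} → a ≤ X a → q (X a) ≤ q a
upperFirst≤ {X} {q} up {a} le with m≤n⇒m<n∨m≡n le
... | inj₁ lt = <⇒≤ (up lt)
... | inj₂ e  = ≤-reflexive (cong q (sym e))

-- The hypothesis compares the last entry of one cycle with the first entry of the other, so it is
-- the tightest of the four inequalities.
spread : ∀ {X q : ℕ → ℕ} → (∀ {a} → a < X a → q (X a) < q a) →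
         ∀ {a b} → a ≤ X a → b ≤ X b → q a < q (X b) → Before X q a b
spread {X} {q} up la lb lt = before
  (<-≤-trans lt b≤)
  (≤-<-trans a≤ (<-≤-trans lt b≤))
  lt
  (≤-<-trans a≤ lt)
  where
  a≤ = upperFirst≤ {X} {q} up la
  b≤ = upperFirst≤ {X} {q} up lb

-- Comparing the larger and the smaller elements of two cycles reduces every case to `ordered`.
cycles-ordered : ∀ {X q} → Involutive X → Atom X q → ∀ {j k} → j < k → X j < X k → Before X q j k
cycles-ordered {X} {q} inv A {j} {k} j<k Xj<Xk with ≤-total j (X j) | ≤-total k (X k)
... | inj₁ lj | inj₁ lk = spread {X} {q} (upperFirst A) lj lk (ordered A lj lk j<k Xj<Xk)
... | inj₁ lj | inj₂ gk = before-Xʳ inv (spread {X} {q} (upperFirst A) lj lk (ordered A lj lk (≤-<-trans lj Xj<Xk)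
        (subst (X j <_) (sym (inv k)) (<-≤-trans Xj<Xk gk))))
  where lk = subst (X k ≤_) (sym (inv k)) gk
... | inj₂ gj | inj₁ lk = before-Xˡ inv (spread {X} {q} (upperFirst A) lj lk (ordered A lj lk (≤-<-trans gj j<k)
        (subst (_< X k) (sym (inv j)) (<-≤-trans j<k lk))))
  where lj = subst (X j ≤_) (sym (inv j)) gj
... | inj₂ gj | inj₂ gk = before-Xˡ inv (before-Xʳ inv (spread {X} {q} (upperFirst A) lj lk (ordered A lj lk Xj<Xk
        (subst₂ _<_ (sym (inv j)) (sym (inv k)) j<k))))
  where
  lj = subst (X j ≤_) (sym (inv j)) gj
  lk = subst (X k ≤_) (sym (inv k)) gk

≮∧≢⇒> : ∀ {a b} → ¬ a < b → a ≢ b → b < a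
≮∧≢⇒> {a} {b} p q with <-cmp a b
... | tri< l _ _ = ⊥-elim (p l)
... | tri≈ _ e _ = ⊥-elim (q e)
... | tri> _ _ g = g

module Conjugate {X q : ℕ → ℕ} (inv : Involutive X) (i : ℕ) where

  conj : ℕ → ℕ
  conj a = sw i (X (sw i a))

  -- Precomposition exchanges the positions of the values i and i + 1: w becomes w s_i, and u
  -- becomes s_i u.
  q′ : ℕ → ℕ
  q′ a = q (sw i a)

  conj-involutive : Involutive conj
  conj-involutive a = begin
    sw i (X (sw i (sw i (X (sw i a))))) ≡⟨ cong (sw i ∘ X) (sw-involutive i _) ⟩
    sw i (X (X (sw i a)))               ≡⟨ cong (sw i) (inv _) ⟩
    sw i (sw i a)                       ≡⟨ sw-involutive i a ⟩
    a                                   ∎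
    where open ≡-Reasoning

  -- The hypotheses treat the pairs of values whose order is changed by sw i.
  atom-conj : Atom X q →
    X (suc i) ≢ i →
    ¬ (X i ≡ i × X (suc i) ≡ suc i) →
    (suc i < X (suc i) → q (X (suc i)) < q i → q (suc i) < q i) →
    (X i < i → q i < q (suc i) → q (X i) < q (suc i)) →
    (suc i ≤ X (suc i) → X (suc i) < X i → q (suc i) < q (X i)) →
    (X i ≤ i → X (suc i) < X i → q (X (suc i)) < q i) →
    Atom conj q′
  atom-conj A n₁ n₂ g₁ g₂ g₃ g₄ = record
    { upperFirst = λ {a} → up (sw i a) a (sw-involutive i a)
    ; noneInside = λ {a} {e} → ins (sw i a) (sw i e) a e (sw-involutive i a) (sw-involutive i e)
    ; ordered    = λ {a} {b} → ord (sw i a) (sw i b) a b (sw-involutive i a) (sw-involutive i b)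
    }
    where
    n₁′ : ∀ {a} → a ≡ suc i → X a ≢ i
    n₁′ refl = n₁

    -- Replacing a by `sw i a` cancels `sw` inside q and X. It survives only in comparisons of
    -- values, where `sw-<⁻` and `sw-≤⁻` isolate the reversed pair.
    up : ∀ a a₀ → sw i a ≡ a₀ → a₀ < sw i (X a) → q (sw i (sw i (X a))) < q a
    up a _ refl lt rewrite sw-involutive i (X a) with sw-<⁻ i lt
    ... | inj₁ l       = upperFirst A l
    ... | inj₂ (p , r) = ⊥-elim (n₁′ p r)

    ins : ∀ a e a₀ e₀ → sw i a ≡ a₀ → sw i e ≡ e₀ → a₀ < e₀ → e₀ < sw i (X a) →
          q (sw i (sw i (X a))) < q e → q a < q e
    ins a e _ _ refl refl l₁ l₂ l₃ rewrite sw-involutive i (X a)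
      with sw-<⁻ i l₁ | sw-<⁻ i l₂ | sw-<⁻ i (<-trans l₁ l₂)
    ... | inj₁ m₁ | inj₁ m₂ | _ = noneInside A m₁ m₂ l₃
    ... | _ | _ | inj₂ (p , r) = ⊥-elim (n₁′ p r)
    ... | inj₂ (refl , refl) | _ | inj₁ m = g₁ m l₃
    ... | inj₁ m₁ | inj₂ (refl , r) | inj₁ m = subst (λ z → q z < q (suc i)) (sym a≡)
            (g₂ (subst (_< i) a≡ (subst (a <_) r m)) (subst (λ z → q z < q (suc i)) r l₃))
      where
      a≡ : a ≡ X i
      a≡ = trans (sym (inv a)) (cong X r)

    ord : ∀ a b a₀ b₀ → sw i a ≡ a₀ → sw i b ≡ b₀ → a₀ ≤ sw i (X a) → b₀ ≤ sw i (X b) →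
          a₀ < b₀ → sw i (X a) < sw i (X b) → q a < q (sw i (sw i (X b)))
    ord a b _ _ refl refl l₁ l₂ l₃ l₄ rewrite sw-involutive i (X b)
      with sw-≤⁻ i l₁ | sw-≤⁻ i l₂ | sw-<⁻ i l₃ | sw-<⁻ i l₄
    ... | inj₂ (p , r) | _ | _ | _ = ⊥-elim (n₁′ p r)
    ... | _ | inj₂ (p , r) | _ | _ = ⊥-elim (n₁′ p r)
    ... | inj₁ m₁ | inj₁ m₂ | inj₁ m₃ | inj₁ m₄ = ordered A m₁ m₂ m₃ m₄
    ... | inj₁ m₁ | inj₁ m₂ | inj₂ (refl , refl) | inj₁ m₄ = g₃ m₁ m₄
    ... | inj₁ m₁ | inj₁ m₂ | inj₂ (refl , refl) | inj₂ (p , r) = ⊥-elim (n₂ (r , p))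
    ... | inj₁ m₁ | inj₁ m₂ | inj₁ m₃ | inj₂ (p , r) =
      subst₂ (λ y z → q y < q z) (sym a≡) (sym r)
        (g₄ (subst₂ _≤_ b≡ r m₂) (subst₂ _<_ a≡ b≡ m₃))
      where
      a≡ : a ≡ X (suc i)
      a≡ = trans (sym (inv a)) (cong X p)
      b≡ : b ≡ X i
      b≡ = trans (sym (inv b)) (cong X r)

  -- The whole cycle of i precedes that of i + 1. This contradicts the premise of the first order
  -- condition and gives the conclusion of the second; the other two presuppose a descent of X.
  atom-conj-up : Atom X q → X i < X (suc i) → ¬ (X i ≡ i × X (suc i) ≡ suc i) → Atom conj q′
  atom-conj-up A lt nf = atom-conj A
    (λ e → <-asym (n<1+n i) (subst₂ _<_ (trans (cong X (sym e)) (inv _)) e lt))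
    nf
    (λ _ l → ⊥-elim (<-asym l (b₃ B)))
    (λ _ _ → b₂ B)
    (λ _ l → ⊥-elim (<-asym l lt))
    (λ _ l → ⊥-elim (<-asym l lt))
    where B = cycles-ordered inv A (n<1+n i) lt

  -- The descent of q settles the first two order conditions. The other two concern nested cycles,
  -- that of i + 1 inside that of i or the reverse, and `noneInside` for the outer cycle decides
  -- them.
  atom-conj-down : Injective q → Atom X q → X (suc i) < X i → X i ≢ suc i → q (suc i) < q i → Atom conj q′
  atom-conj-down qinj A gt nc d = atom-conj A
    (λ e → nc (trans (cong X (sym e)) (inv _)))
    (λ (p , r) → <-asym (n<1+n i) (subst₂ _<_ r p gt))
    (λ _ _ → d)
    (λ _ l → ⊥-elim (<-asym l d))
    (λ l _ → ≮∧≢⇒> (λ l′ → <-asym d (noneInside A (n<1+n i) (≤-<-trans l gt) l′)) (nc ∘ qinj))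
    (λ l _ → noneInside′ (<-≤-trans gt l))
    where
    noneInside′ : X (suc i) < i → q (X (suc i)) < q i
    noneInside′ l = noneInside A l (subst (i <_) (sym (inv _)) (n<1+n i))
                      (subst (λ z → q z < q i) (sym (inv _)) d)

  -- If X fixes or exchanges i and i + 1, conjugation by s_i only returns X. The relevant involution
  -- is then s_i X, which joins the two fixed points into a cycle or separates them again.
  newCycle : ℕ → ℕ
  newCycle a = sw i (X a)

  q′-newCycle : ∀ a → q′ (newCycle a) ≡ q (X a)
  q′-newCycle a = cong q (sw-involutive i (X a))

  -- The fixed points i and i + 1 stand in increasing order in u and change places, so the larger
  -- one comes first. No other cycle contains i or i + 1, hence a bound by one of them transfers to
  -- the other.
  atom-merge : Atom X q → X i ≡ i → X (suc i) ≡ suc i → Atom newCycle q′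
  atom-merge A f₁ f₂ = record
    { upperFirst = λ {a} → up (swView i a)
    ; noneInside = λ {a} {e} → ins (swView i a) (swView i e)
    ; ordered    = λ {a} {b} → ord (swView i a) (swView i b)
    }
    where
    X′i : newCycle i ≡ suc i
    X′i = trans (cong (sw i) f₁) (sw-left i)
    X′si : newCycle (suc i) ≡ i
    X′si = trans (cong (sw i) f₂) (sw-right i)
    Xo₁ : ∀ {a} → a ≢ i → X a ≢ i
    Xo₁ p e = p (trans (sym (inv _)) (trans (cong X e) f₁))
    Xo₂ : ∀ {a} → a ≢ suc i → X a ≢ suc i
    Xo₂ p e = p (trans (sym (inv _)) (trans (cong X e) f₂))
    X′o : ∀ {a} → a ≢ i → a ≢ suc i → newCycle a ≡ X a
    X′o p r = sw-other i (Xo₁ p) (Xo₂ r)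

    up : ∀ {a} → SwView i a → a < newCycle a → q′ (newCycle a) < q′ a
    up {a} v lt rewrite q′-newCycle a with v
    ... | left rewrite f₁ | sw-left i =
            b₁ (cycles-ordered inv A (n<1+n i) (subst₂ _<_ (sym f₁) (sym f₂) (n<1+n i)))
    ... | right = ⊥-elim (<-asym (n<1+n i) (subst (suc i <_) X′si lt))
    ... | other p r rewrite sw-other i p r = upperFirst A (subst (a <_) (X′o p r) lt)

    ins : ∀ {a e} → SwView i a → SwView i e → a < e → e < newCycle a →
          q′ (newCycle a) < q′ e → q′ a < q′ e
    ins left  _ l₁ l₂ _ = ⊥-elim (<-irrefl refl (<-≤-trans l₁ (s≤s⁻¹ (subst (_ <_) X′i l₂))))
    ins right _ l₁ l₂ _ = ⊥-elim (<-asym (<-trans l₁ l₂) (subst (_< suc i) (sym X′si) (n<1+n i)))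
    ins {a} {e} (other p r) v l₁ l₂ l₃ rewrite q′-newCycle a | sw-other i p r | X′o p r with v
    ... | left rewrite sw-left i = noneInside A (m<n⇒m<1+n l₁) (≤∧≢⇒< l₂ (Xo₂ r ∘ sym)) l₃
    ... | right rewrite sw-right i = noneInside A (≤∧≢⇒< (s≤s⁻¹ l₁) p) (<-trans (n<1+n i) l₂) l₃
    ... | other p′ r′ rewrite sw-other i p′ r′ = noneInside A l₁ l₂ l₃

    ord : ∀ {a b} → SwView i a → SwView i b → a ≤ newCycle a → b ≤ newCycle b → a < b →
          newCycle a < newCycle b → q′ a < q′ (newCycle b)
    ord right _ l₁ _ _ _ = ⊥-elim (1+n≰n (subst (suc i ≤_) X′si l₁))
    ord _ right _ l₂ _ _ = ⊥-elim (1+n≰n (subst (suc i ≤_) X′si l₂))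
    ord left left _ _ l₃ _ = ⊥-elim (<-irrefl refl l₃)
    ord {_} {b} left (other p r) _ l₂ l₃ l₄ rewrite q′-newCycle b | sw-left i | X′o p r =
      ordered A (≤-reflexive (sym f₂)) l₂ (≤∧≢⇒< l₃ (r ∘ sym))
        (subst (_< X b) (sym f₂) (subst (_< X b) X′i l₄))
    ord {a} (other p r) left l₁ _ l₃ l₄ rewrite q′-newCycle i | sw-other i p r | X′o p r =
      ordered A l₁ (≤-reflexive (sym f₁)) l₃
        (subst (X a <_) (sym f₁) (≤∧≢⇒< (s≤s⁻¹ (subst (X a <_) X′i l₄)) (Xo₁ p)))
    ord {a} {b} (other p r) (other p′ r′) l₁ l₂ l₃ l₄
      rewrite q′-newCycle b | sw-other i p r | X′o p r | X′o p′ r′ = ordered A l₁ l₂ l₃ l₄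

  -- Undoes `atom-merge`. The cycle inequalities of X bound q (i + 1) from below and q i from above;
  -- when a new fixed point asks for the other entry, the descent `d` supplies the difference.
  atom-split : Atom X q → X i ≡ suc i → Atom newCycle q′
  atom-split A f₁ = record
    { upperFirst = λ {a} → up (swView i a)
    ; noneInside = λ {a} {e} → ins (swView i a) (swView i e)
    ; ordered    = λ {a} {b} → ord (swView i a) (swView i b)
    }
    where
    f₂ : X (suc i) ≡ i
    f₂ = trans (cong X (sym f₁)) (inv i)
    i<Xi : i < X i
    i<Xi = subst (i <_) (sym f₁) (n<1+n i)
    d : q (suc i) < q i
    d = subst (λ z → q z < q i) f₁ (upperFirst A i<Xi)
    X′i : newCycle i ≡ i
    X′i = trans (cong (sw i) f₁) (sw-right i)
    X′si : newCycle (suc i) ≡ suc i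
    X′si = trans (cong (sw i) f₂) (sw-left i)
    Xo₁ : ∀ {a} → a ≢ suc i → X a ≢ i
    Xo₁ p e = p (trans (sym (inv _)) (trans (cong X e) f₁))
    Xo₂ : ∀ {a} → a ≢ i → X a ≢ suc i
    Xo₂ p e = p (trans (sym (inv _)) (trans (cong X e) f₂))
    X′o : ∀ {a} → a ≢ i → a ≢ suc i → newCycle a ≡ X a
    X′o p r = sw-other i (Xo₁ r) (Xo₂ p)

    up : ∀ {a} → SwView i a → a < newCycle a → q′ (newCycle a) < q′ a
    up left  lt = ⊥-elim (<-irrefl refl (subst (i <_) X′i lt))
    up right lt = ⊥-elim (<-irrefl refl (subst (suc i <_) X′si lt))
    up {a} (other p r) lt rewrite q′-newCycle a | sw-other i p r =
      upperFirst A (subst (a <_) (X′o p r) lt)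

    ins : ∀ {a e} → SwView i a → SwView i e → a < e → e < newCycle a →
          q′ (newCycle a) < q′ e → q′ a < q′ e
    ins left  _ l₁ l₂ _ = ⊥-elim (<-asym l₁ (subst (_ <_) X′i l₂))
    ins right _ l₁ l₂ _ = ⊥-elim (<-asym l₁ (subst (_ <_) X′si l₂))
    ins {a} {e} (other p r) v l₁ l₂ l₃ rewrite q′-newCycle a | sw-other i p r | X′o p r with v
    ... | left rewrite sw-left i = noneInside A (m<n⇒m<1+n l₁) (≤∧≢⇒< l₂ (Xo₂ p ∘ sym)) l₃
    ... | right rewrite sw-right i = noneInside A (≤∧≢⇒< (s≤s⁻¹ l₁) p) (<-trans (n<1+n i) l₂) l₃
    ... | other p′ r′ rewrite sw-other i p′ r′ = noneInside A l₁ l₂ l₃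

    ord : ∀ {a b} → SwView i a → SwView i b → a ≤ newCycle a → b ≤ newCycle b → a < b →
          newCycle a < newCycle b → q′ a < q′ (newCycle b)
    ord left  left  _ _ l₃ _ = ⊥-elim (<-irrefl refl l₃)
    ord right right _ _ l₃ _ = ⊥-elim (<-irrefl refl l₃)
    ord right left  _ _ l₃ _ = ⊥-elim (<-asym (n<1+n i) l₃)
    ord left right _ _ _ _ rewrite q′-newCycle (suc i) | sw-left i | f₂ = d
    ord {_} {b} left (other p r) _ l₂ l₃ l₄ rewrite q′-newCycle b | sw-left i | X′o p r | X′i =
      <-trans d (ordered A (<⇒≤ i<Xi) l₂ l₃ (subst (_< X b) (sym f₁) (≤∧≢⇒< l₄ (Xo₂ p ∘ sym))))
    ord {_} {b} right (other p r) _ l₂ l₃ l₄ rewrite q′-newCycle b | sw-right i | X′o p r | X′si =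
      ordered A (<⇒≤ i<Xi) l₂ (<-trans (n<1+n i) l₃) (subst (_< X b) (sym f₁) l₄)
    ord {a} (other p r) left l₁ _ l₃ l₄ rewrite q′-newCycle i | sw-other i p r | X′o p r | X′i =
      ordered A l₁ (<⇒≤ i<Xi) l₃ (subst (X a <_) (sym f₁) (m<n⇒m<1+n l₄))
    ord {a} (other p r) right l₁ _ l₃ l₄ rewrite q′-newCycle (suc i) | sw-other i p r | X′o p r | X′si | f₂ =
      <-trans (subst (λ z → q a < q z) f₁ (ordered A l₁ (<⇒≤ i<Xi) a<i
        (subst (X a <_) (sym f₁) l₄))) d
      where
      a<i : a < i
      a<i = ≤∧≢⇒< (s≤s⁻¹ l₃) p
    ord {a} {b} (other p r) (other p′ r′) l₁ l₂ l₃ l₄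
      rewrite q′-newCycle b | sw-other i p r | X′o p r | X′o p′ r′ = ordered A l₁ l₂ l₃ l₄

-- Atoms under the relation ≺A, and its extremal atoms

<-suc-absurd : ∀ {m k} → k < m → ¬ m < suc k
<-suc-absurd l₁ l₂ = <-irrefl refl (<-≤-trans l₁ (s≤s⁻¹ l₂))

-- If y lies strictly between z and `X z`, or z between `X y` and y, then `noneInside` and
-- `upperFirst` force an entry strictly between the adjacent y and z. If z < X y and X z < y, the
-- cycle of z lies to the left of that of y, so z would come first.
descent-is-cycle : ∀ {X q} → Involutive X → Injective q → Atom X q →
                   ∀ {y z} → z < y → q z ≡ suc (q y) → z ≡ X y
descent-is-cycle {X} {q} inv qinj A {y} {z} z<y e with <-cmp y (X z)
... | tri≈ _ p _ = trans (sym (inv z)) (cong X (sym p))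
... | tri< y<Xz y≢Xz _ = ⊥-elim (<-suc-absurd qy<qXz (subst (q (X z) <_) e (upperFirst A (<-trans z<y y<Xz))))
  where
  qy<qz : q y < q z
  qy<qz = subst (q y <_) (sym e) (n<1+n _)
  qy<qXz : q y < q (X z)
  qy<qXz = ≮∧≢⇒> (λ l → <-asym qy<qz (noneInside A z<y y<Xz l)) (y≢Xz ∘ sym ∘ qinj)
... | tri> _ _ Xz<y with <-cmp (X y) z
...   | tri≈ _ p _ = sym p
...   | tri< Xy<z _ _ = ⊥-elim (<-suc-absurd
          (subst (λ t → q t < q (X y)) (inv y) (upperFirst A (subst (X y <_) (sym (inv y)) (<-trans Xy<z z<y))))
          (subst (q (X y) <_) e (noneInside A Xy<z (subst (z <_) (sym (inv y)) z<y)
            (subst₂ _<_ (cong q (sym (inv y))) (sym e) (n<1+n _)))))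
...   | tri> _ _ z<Xy = ⊥-elim (<-asym (n<1+n _) (subst (_< q y) e
          (b₁ (before-Xʳ inv (cycles-ordered inv A z<Xy (subst (X z <_) (sym (inv y)) Xz<y))))))

-- q and r are the position functions before and after c a b → b c a at positions k, k + 1, k + 2.
-- The entry b passes a and then c, which gives the two adjacent exchanges in `r≡`.
module Step {X q r : ℕ → ℕ} (inv : Involutive X) (qinj : Injective q)
            {a b c k : ℕ} (a<b : a < b) (b<c : b < c)
            (qc : q c ≡ k) (qa : q a ≡ suc k) (qb : q b ≡ suc (suc k))
            (r≡ : ∀ e → r e ≡ sw k (sw (suc k) (q e))) where

  rc : r c ≡ suc k
  rc rewrite r≡ c | qc | sw-other (suc k) {k} (<⇒≢ (n<1+n k)) (<⇒≢ (m<n⇒m<1+n (n<1+n k))) = sw-left k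

  ra : r a ≡ suc (suc k)
  ra rewrite r≡ a | qa | sw-left (suc k) = sw-other k (λ ()) (λ ())

  rb : r b ≡ k
  rb rewrite r≡ b | qb | sw-right (suc k) = sw-right k

  rinj : Injective r
  rinj {y} {z} e = qinj (sw-injective (suc k) (sw-injective k (trans (sym (r≡ y)) (trans e (r≡ z)))))

  -- The pairs reversed by the step, listed in both orders so that the same exclusion serves the
  -- passage from q to r and from r to q.
  Swapped : ℕ → ℕ → Set
  Swapped y z = (y ≡ b × (z ≡ a ⊎ z ≡ c)) ⊎ (z ≡ b × (y ≡ a ⊎ y ≡ c))

  at₀ : ∀ {y} → q y ≡ k → y ≡ c
  at₀ e = qinj (trans e (sym qc))
  at₁ : ∀ {y} → q y ≡ suc k → y ≡ a
  at₁ e = qinj (trans e (sym qa))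
  at₂ : ∀ {y} → q y ≡ suc (suc k) → y ≡ b
  at₂ e = qinj (trans e (sym qb))

  sw₁⁻ : ∀ {y m} → sw (suc k) (q y) ≡ m → q y ≡ sw (suc k) m
  sw₁⁻ {y} e = trans (sym (sw-involutive (suc k) (q y))) (cong (sw (suc k)) e)

  sw-k : sw (suc k) k ≡ k
  sw-k = sw-other (suc k) (<⇒≢ (n<1+n k)) (<⇒≢ (m<n⇒m<1+n (n<1+n k)))

  q⇒r : ∀ {y z} → ¬ Swapped y z → q y < q z → r y < r z
  q⇒r {y} {z} ns lt with sw-< (suc k) lt
  ... | inj₂ (p , p′) = ⊥-elim (ns (inj₂ (at₂ p′ , inj₁ (at₁ p))))
  ... | inj₁ l with sw-< k l
  ...   | inj₁ l′ = subst₂ _<_ (sym (r≡ y)) (sym (r≡ z)) l′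
  ...   | inj₂ (p , p′) = ⊥-elim (ns (inj₂
            ( at₂ (trans (sw₁⁻ p′) (sw-left (suc k)))
            , inj₂ (at₀ (trans (sw₁⁻ p) sw-k)))))

  r⇒q : ∀ {y z} → ¬ Swapped y z → r y < r z → q y < q z
  r⇒q {y} {z} ns lt with sw-<⁻ k (subst₂ _<_ (r≡ y) (r≡ z) lt)
  ... | inj₂ (p , p′) = ⊥-elim (ns (inj₁
            ( at₂ (trans (sw₁⁻ p) (sw-left (suc k)))
            , inj₂ (at₀ (trans (sw₁⁻ p′) sw-k)))))
  ... | inj₁ l with sw-<⁻ (suc k) l
  ...   | inj₁ l′ = l′
  ...   | inj₂ (p , p′) = ⊥-elim (ns (inj₁ (at₂ p , inj₁ (at₁ p′))))

  a<c : a < c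
  a<c = <-trans a<b b<c

  -- b moves across the adjacent pair c, a; since the cycle of b lies inside (a , c),
  -- no condition of Atom relates them except noneInside for (a , c).
  transfer : ∀ {s t : ℕ → ℕ} → X a ≡ c → a < X b → X b < c →
             (∀ {y z} → ¬ Swapped y z → s y < s z → t y < t z) →
             (∀ {y z} → ¬ Swapped y z → t y < t z → s y < s z) →
             (t c < t b → t a < t b) →
             Atom X s → Atom X t
  transfer {s} {t} Xa a<Xb Xb<c s⇒t t⇒s H A = record
    { upperFirst = λ {f} lt → s⇒t (ns-up f) (upperFirst A lt)
    ; noneInside = ins
    ; ordered    = λ {f} {g} l₁ l₂ l₃ l₄ → s⇒t (ns-ord l₁ l₂ l₃ l₄) (ordered A l₁ l₂ l₃ l₄)
    }
    where
    Xc : X c ≡ a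
    Xc = trans (cong X (sym Xa)) (inv a)

    Xb≢ : ¬ (X b ≡ a ⊎ X b ≡ c)
    Xb≢ (inj₁ e) = <⇒≢ a<Xb (sym e)
    Xb≢ (inj₂ e) = <⇒≢ Xb<c e

    ns-up : ∀ f → ¬ Swapped (X f) f
    ns-up f (inj₁ (p , inj₁ refl)) = <⇒≢ b<c (trans (sym p) Xa)
    ns-up f (inj₁ (p , inj₂ refl)) = <⇒≢ a<b (trans (sym Xc) p)
    ns-up f (inj₂ (refl , o)) = Xb≢ o

    inv≡ : ∀ {f g} → X f ≡ g → f ≡ X g
    inv≡ {f} e = trans (sym (inv f)) (cong X e)

    ns-f : ∀ {f e} → f < e → e < X f → f ≢ a → ¬ Swapped f e
    ns-f l₁ l₂ _ (inj₁ (refl , inj₁ refl)) = <-asym a<b l₁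
    ns-f l₁ l₂ _ (inj₁ (refl , inj₂ refl)) = <-asym Xb<c l₂
    ns-f l₁ l₂ n (inj₂ (refl , inj₁ p)) = n p
    ns-f l₁ l₂ _ (inj₂ (refl , inj₂ refl)) = <-asym b<c l₁

    ns-Xf : ∀ {f e} → f < e → e < X f → f ≢ a → ¬ Swapped (X f) e
    ns-Xf l₁ l₂ _ (inj₁ (p , inj₁ refl)) = <-asym a<Xb (subst (_< a) (inv≡ p) l₁)
    ns-Xf l₁ l₂ _ (inj₁ (p , inj₂ refl)) = <-asym b<c (subst (c <_) p l₂)
    ns-Xf l₁ l₂ _ (inj₂ (refl , inj₁ p)) = <-asym a<b (subst (b <_) p l₂)
    ns-Xf l₁ l₂ n (inj₂ (refl , inj₂ p)) = n (trans (inv≡ p) Xc)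

    ins : ∀ {f e} → f < e → e < X f → t (X f) < t e → t f < t e
    ins {f} {e} l₁ l₂ l₃ with f ≟ a | e ≟ b
    ... | no f≢a   | _        = s⇒t (ns-f l₁ l₂ f≢a) (noneInside A l₁ l₂ (t⇒s (ns-Xf l₁ l₂ f≢a) l₃))
    -- The one reversed pair that `Atom` mentions. Upward, the premise fails because b now precedes
    -- c; downward, the conclusion holds because a precedes b.
    ... | yes refl | yes refl = H (subst (λ z → t z < t b) Xa l₃)
    ... | yes refl | no e≢b   = s⇒t ns₁ (noneInside A l₁ l₂ (t⇒s ns₂ l₃))
      where
      ns₁ : ¬ Swapped a e
      ns₁ (inj₁ (p , _)) = <⇒≢ a<b p
      ns₁ (inj₂ (p , _)) = e≢b p
      ns₂ : ¬ Swapped (X a) e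
      ns₂ (inj₁ (p , _)) = <⇒≢ b<c (trans (sym p) Xa)
      ns₂ (inj₂ (p , _)) = e≢b p

    ns-ord : ∀ {f g} → f ≤ X f → g ≤ X g → f < g → X f < X g → ¬ Swapped f (X g)
    ns-ord l₁ l₂ l₃ l₄ (inj₁ (refl , inj₁ p)) =
      <⇒≱ a<c (subst₂ _≤_ (trans (inv≡ p) Xa) p l₂)
    ns-ord l₁ l₂ l₃ l₄ (inj₁ (refl , inj₂ p)) = <-asym a<b (subst (b <_) (trans (inv≡ p) Xc) l₃)
    ns-ord l₁ l₂ l₃ l₄ (inj₂ (p , inj₁ refl)) = <-asym b<c (subst₂ _<_ Xa p l₄)
    ns-ord l₁ l₂ l₃ l₄ (inj₂ (p , inj₂ refl)) = <⇒≱ a<c (subst (c ≤_) Xc l₁)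

  private
    partner : a ≡ X c → X a ≡ c
    partner e = trans (cong X e) (inv c)

  -- The descent c a is a cycle, and `X b` must lie between a and c. If X b < a, the cycle of b
  -- would have to precede c; if c < X b, then `X b` would stand strictly between the adjacent
  -- entries a and b.
  atom-up : Atom X q → Atom X r
  atom-up A = transfer {q} {r} Xa (≮∧≢⇒> (λ l → ¬low l) Xb≢a) (≮∧≢⇒> (λ l → ¬high l) (Xb≢c ∘ sym))
                q⇒r r⇒q (λ l → ⊥-elim (<-asym (n<1+n k) (subst₂ _<_ rc rb l))) A
    where
    a≡ : a ≡ X c
    a≡ = descent-is-cycle inv qinj A a<c (trans qa (cong suc (sym qc)))
    Xa = partner a≡
    Xb≢a : X b ≢ a
    Xb≢a e = <⇒≢ b<c (trans (sym (inv b)) (trans (cong X e) Xa))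
    Xb≢c : X b ≢ c
    Xb≢c e = <⇒≢ a<b (trans a≡ (trans (cong X (sym e)) (inv b)))
    ¬low : ¬ X b < a
    ¬low l = <-asym (m<n⇒m<1+n (n<1+n k)) (subst₂ _<_ qb qc
               (b₁ (cycles-ordered inv A b<c (subst (X b <_) a≡ l))))
    ¬high : ¬ c < X b
    ¬high l = <-suc-absurd (subst (_< q (X b)) qa (b₃ (cycles-ordered inv A a<b (subst (_< X b) (sym Xa) l))))
                (subst (q (X b) <_) qb (upperFirst A (<-trans b<c l)))

  -- Now b stands in front of c a, and the two exclusions trade arguments: X b < a leaves no room
  -- between b and c, and c < X b would put a before b.
  atom-down : Atom X r → Atom X q
  atom-down A = transfer {r} {q} Xa (≮∧≢⇒> (λ l → ¬low l) Xb≢a) (≮∧≢⇒> (λ l → ¬high l) (Xb≢c ∘ sym))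
                r⇒q q⇒r (λ _ → subst₂ _<_ (sym qa) (sym qb) (n<1+n _)) A
    where
    a≡ : a ≡ X c
    a≡ = descent-is-cycle inv rinj A a<c (trans ra (cong suc (sym rc)))
    Xa = partner a≡
    Xb≢a : X b ≢ a
    Xb≢a e = <⇒≢ b<c (trans (sym (inv b)) (trans (cong X e) Xa))
    Xb≢c : X b ≢ c
    Xb≢c e = <⇒≢ a<b (trans a≡ (trans (cong X (sym e)) (inv b)))
    ¬low : ¬ X b < a
    ¬low l = <-suc-absurd
      (subst₂ _<_ (trans (cong r (inv b)) rb) refl
        (upperFirst A (subst (X b <_) (sym (inv b)) (<-trans l a<b))))
      (subst (r (X b) <_) rc (b₂ (cycles-ordered inv A b<c (subst (X b <_) a≡ l))))
    ¬high : ¬ c < X b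
    ¬high l = <-asym (m<n⇒m<1+n (n<1+n k)) (subst₂ _<_ ra rb
               (b₁ (cycles-ordered inv A a<b (subst (_< X b) (sym Xa) l))))

-- Extremal atoms: cycles listed by minimum or by maximum

UpperFirst : (X q : ℕ → ℕ) → Set
UpperFirst X q = ∀ {a} → a < X a → q (X a) < q a

-- Nested cycles are compared here as well, so whole cycles follow each other in the order of their
-- minima.
record SortedByLower (X q : ℕ → ℕ) : Set where
  field
    upperFirst : UpperFirst X q
    ordered    : ∀ {a b} → a ≤ X a → b ≤ X b → a < b → q a < q (X b)

record SortedByUpper (X q : ℕ → ℕ) : Set where
  field
    upperFirst : UpperFirst X q
    ordered    : ∀ {a b} → X a ≤ a → X b ≤ b → a < b → q (X a) < q b

module _ {X q : ℕ → ℕ} where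

  lower-before : SortedByLower X q → ∀ {a b} → a ≤ X a → b ≤ X b → a < b → Before X q a b
  lower-before S la lb lt = spread {X} {q} (SortedByLower.upperFirst S) la lb (SortedByLower.ordered S la lb lt)

  upper-before : Involutive X → SortedByUpper X q → ∀ {a b} → X a ≤ a → X b ≤ b → a < b → Before X q a b
  upper-before inv S {a} {b} ga gb lt = before-Xˡ inv (before-Xʳ inv
    (spread {X} {q} (SortedByUpper.upperFirst S)
      (subst (X a ≤_) (sym (inv a)) ga) (subst (X b ≤_) (sym (inv b)) gb)
      (subst (λ z → q (X a) < q z) (sym (inv b)) (SortedByUpper.ordered S ga gb lt))))

  -- For `noneInside`, compare the minimum of the cycle of e with a. If it is larger, that cycle
  -- comes after a; if it is smaller, that cycle comes before `X a`, against the premise.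
  lower⇒atom : Involutive X → SortedByLower X q → Atom X q
  lower⇒atom inv S = record
    { upperFirst = SortedByLower.upperFirst S
    ; noneInside = ins
    ; ordered    = λ la lb lt _ → SortedByLower.ordered S la lb lt
    }
    where
    ins : ∀ {a e} → a < e → e < X a → q (X a) < q e → q a < q e
    ins {a} {e} l₁ l₂ l₃ with ≤-total e (X e)
    ... | inj₁ le = b₁ (lower-before S (<⇒≤ (<-trans l₁ l₂)) le l₁)
    ... | inj₂ ge with <-cmp a (X e)
    ...   | tri< l _ _ = b₁ (before-Xʳ inv (lower-before S (<⇒≤ (<-trans l₁ l₂)) (subst (X e ≤_) (sym (inv e)) ge) l))
    ...   | tri≈ _ p _ = ⊥-elim (<⇒≢ l₂ (trans (sym (inv e)) (cong X (sym p))))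
    ...   | tri> _ _ l = ⊥-elim (<-asym l₃ (b₃ (before-Xˡ inv
              (lower-before S (subst (X e ≤_) (sym (inv e)) ge) (<⇒≤ (<-trans l₁ l₂)) l))))

  upper⇒atom : Involutive X → SortedByUpper X q → Atom X q
  upper⇒atom inv S = record
    { upperFirst = SortedByUpper.upperFirst S
    ; noneInside = ins
    ; ordered    = λ la lb _ lt → b₁ (before-Xˡ inv (upper-before inv S (X-upper la) (X-upper lb) lt))
    }
    where
    X-upper : ∀ {a} → a ≤ X a → X (X a) ≤ X a
    X-upper {a} = subst (_≤ X a) (sym (inv a))

    ins : ∀ {a e} → a < e → e < X a → q (X a) < q e → q a < q e
    ins {a} {e} l₁ l₂ l₃ with ≤-total (X e) e
    ... | inj₁ ge = ⊥-elim (<-asym l₃ (b₁ (upper-before inv S ge (X-upper (<⇒≤ (<-trans l₁ l₂))) l₂)))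
    ... | inj₂ le with <-cmp (X e) (X a)
    ...   | tri< l _ _ = ⊥-elim (<-asym l₃ (b₁ (before-Xˡ inv
              (upper-before inv S (X-upper le) (X-upper (<⇒≤ (<-trans l₁ l₂))) l))))
    ...   | tri≈ _ p _ = ⊥-elim (<⇒≢ l₁ (sym (involutive⇒injective inv p)))
    ...   | tri> _ _ l = b₁ (before-Xˡ inv (before-Xʳ inv
              (upper-before inv S (X-upper (<⇒≤ (<-trans l₁ l₂))) (X-upper le) l)))

DescentsAreCycles : (X w : ℕ → ℕ) → Set
DescentsAreCycles X w = ∀ k → w (1 + k) < w k → w (1 + k) ≡ X (w k)

NoBCA : (ℕ → ℕ) → Set
NoBCA w = ∀ k → w (2 + k) < w k → w k < w (1 + k) → ⊥

NoCAB : (ℕ → ℕ) → Set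
NoCAB w = ∀ k → w (1 + k) < w (2 + k) → w (2 + k) < w k → ⊥

-- Here w plays the part of the word u, and q that of its inverse.
module Extremal {X q w : ℕ → ℕ} (inv : Involutive X)
                (qw : ∀ k → q (w k) ≡ k) (wq : ∀ a → w (q a) ≡ a)
                (A : Atom X q) where

  winj : Injective w
  winj {a} {b} e = trans (sym (qw a)) (trans (cong q e) (qw b))

  qinj : Injective q
  qinj {a} {b} e = trans (sym (wq a)) (trans (cong w e) (wq b))

  descents : DescentsAreCycles X w
  descents k lt = descent-is-cycle inv qinj A lt (trans (qw (suc k)) (cong suc (sym (qw k))))

  w≢ : ∀ {j k} → j < k → w j ≢ w k
  w≢ lt e = <⇒≢ lt (winj e)

  -- Both descents would be cycles through the middle entry, so the two outer entries would
  -- coincide.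
  no-double-descent : ∀ k → w (1 + k) < w k → w (1 + k) < w (2 + k)
  no-double-descent k l = ≮∧≢⇒>
    (λ l′ → w≢ (m<n⇒m<1+n (n<1+n k))
      (sym (trans (descents (suc k) l′) (trans (cong X (descents k l)) (inv (w k))))))
    (w≢ (n<1+n (suc k)) ∘ sym)

  rise-or-fall : ∀ k → w k < w (1 + k) ⊎ w (1 + k) < w k
  rise-or-fall k with <-cmp (w k) (w (1 + k))
  ... | tri< l _ _ = inj₁ l
  ... | tri≈ _ e _ = ⊥-elim (w≢ (n<1+n k) e)
  ... | tri> _ _ l = inj₂ l

  -- A rise sets a floor. A fall after it lands above the floor, since b c a is excluded, and is
  -- followed by another rise, whose floor is higher.
  low-after : NoBCA w → ∀ d k → w k < w (suc k) → w k < w (suc (d + k))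
  low-after N zero k l = l
  low-after N (suc d) k l with rise-or-fall (suc k)
  ... | inj₁ l′ = <-trans l (subst (λ z → w (suc k) < w (suc z)) (+-suc d k) (low-after N d (suc k) l′))
  ... | inj₂ l′ = step-down d
    where
    above : w k < w (2 + k)
    above = ≮∧≢⇒> (λ l″ → N k l″ l) (w≢ (m<n⇒m<1+n (n<1+n k)) ∘ sym)
    step-down : ∀ d → w k < w (suc (suc d + k))
    step-down zero    = above
    step-down (suc d) = <-trans above (subst (λ z → w (2 + k) < w (suc z))
      (trans (+-suc d (suc k)) (cong suc (+-suc d k)))
      (low-after N d (2 + k) (no-double-descent (suc k) l′)))

  -- The bottom of a descent may drop below y, but its partner is the entry just before it, which is
  -- above y; this is the second alternative. The entry after the bottom rises above that partner,
  -- since c a b is excluded.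
  high-after : NoCAB w → ∀ {y} d k → y < w k → y < w (d + k) ⊎ y < X (w (d + k))
  high-after N zero k l = inj₁ l
  high-after N {y} (suc d) k l with rise-or-fall k
  ... | inj₁ l′ = subst (λ z → y < w z ⊎ y < X (w z)) (+-suc d k) (high-after N d (suc k) (<-trans l l′))
  ... | inj₂ l′ = step-down d
    where
    above : w k < w (2 + k)
    above = ≮∧≢⇒> (N k (no-double-descent k l′)) (w≢ (m<n⇒m<1+n (n<1+n k)) ∘ sym)
    step-down : ∀ d → y < w (suc d + k) ⊎ y < X (w (suc d + k))
    step-down zero    = inj₂ (subst (y <_) (trans (sym (inv (w k))) (cong X (sym (descents k l′)))) l)
    step-down (suc d) = subst (λ z → y < w z ⊎ y < X (w z)) (trans (+-suc d (suc k)) (cong suc (+-suc d k)))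
      (high-after N d (2 + k) (<-trans l above))

  -- Suppose `X b` stands before a. Either a rise follows `X b`, or a fall to its partner b and then
  -- a rise. By `low-after`, a would be b itself or lie above `X b` or b, against a < b.
  noBCA⇒sorted : NoBCA w → SortedByLower X q
  noBCA⇒sorted N = record
    { upperFirst = upperFirst A
    ; ordered    = λ {a} {b} la lb a<b → ≮∧≢⇒> (λ l → contra la lb a<b l)
                     (λ e → <⇒≢ (<-≤-trans a<b lb) (sym (qinj e)))
    }
    where
    contra : ∀ {a b} → a ≤ X a → b ≤ X b → a < b → ¬ q (X b) < q a
    contra {a} {b} la lb a<b l with rise-or-fall (q (X b)) | m≤n⇒∃[o]m+o≡n l
    ... | inj₁ l′ | d , e = <-asym (<-≤-trans a<b lb)
            (subst₂ _<_ (wq (X b)) (trans (cong (w ∘ suc) (+-comm d _)) (trans (cong w e) (wq a)))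
              (low-after N d _ l′))
    ... | inj₂ l′ | zero , e = <⇒≢ a<b (trans (sym (wq a)) (trans (cong w (sym (trans (cong suc (sym (+-identityʳ _))) e)))
            (trans (descents _ l′) (trans (cong X (wq (X b))) (inv b)))))
    ... | inj₂ l′ | suc d , e = <-asym a<b
            (subst₂ _<_ (trans (descents _ l′) (trans (cong X (wq (X b))) (inv b)))
              (trans (cong (w ∘ suc) (trans (+-comm d _) (sym (+-suc _ d)))) (trans (cong w e) (wq a)))
              (low-after N d _ (no-double-descent _ l′)))

  -- Suppose b stands before `X a`. The entry after b, or the one after its partner `X b`, exceeds
  -- b, and `high-after` makes a or `X a` exceed b too. If `X a` is that partner, then a = b.
  noCAB⇒sorted : NoCAB w → SortedByUpper X q
  noCAB⇒sorted N = record
    { upperFirst = upperFirst A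
    ; ordered    = λ {a} {b} ga gb a<b → ≮∧≢⇒> (λ l → contra ga gb a<b l)
                     (λ e → <⇒≢ (≤-<-trans ga a<b) (sym (qinj e)))
    }
    where
    contra : ∀ {a b} → X a ≤ a → X b ≤ b → a < b → ¬ q b < q (X a)
    contra {a} {b} ga gb a<b l with rise-or-fall (q b) | m≤n⇒∃[o]m+o≡n l
    ... | p | d , e = [ (λ l₁ → <-asym (≤-<-trans ga a<b) l₁)
                      , (λ l₂ → <-asym a<b (subst (b <_) (inv a) l₂)) ]′
                      (subst (λ z → b < z ⊎ b < X z) (trans (cong w e) (wq (X a))) (later p d e))
      where
      later : w (q b) < w (1 + q b) ⊎ w (1 + q b) < w (q b) → ∀ d → suc (q b) + d ≡ q (X a) →
              b < w (suc (q b) + d) ⊎ b < X (w (suc (q b) + d))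
      later (inj₁ l′) d e = subst (λ z → b < w z ⊎ b < X (w z)) (+-comm d _)
        (high-after N d _ (subst (_< w (1 + q b)) (wq b) l′))
      later (inj₂ l′) zero e = ⊥-elim (<⇒≢ a<b (involutive⇒injective inv
        (trans (sym (wq (X a))) (trans (cong w (sym (trans (cong suc (sym (+-identityʳ _))) e)))
            (trans (descents _ l′) (cong X (wq b)))))))
      later (inj₂ l′) (suc d) e = subst (λ z → b < w z ⊎ b < X (w z))
        (trans (+-comm d _) (sym (+-suc (suc (q b)) d)))
        (high-after N d _ (subst (_< w (2 + q b)) (wq b)
          (≮∧≢⇒> (N _ (no-double-descent _ l′)) (w≢ (m<n⇒m<1+n (n<1+n _)) ∘ sym))))

-- Representatives decide the order between different cycles, `UpperFirst` the order inside one.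
-- Leaving `Rep` abstract treats minima and maxima by the same argument.
order-determined : ∀ {X q r} → Involutive X → (Rep : ℕ → Set) → (∀ y → Rep y ⊎ Rep (X y)) →
  UpperFirst X q → UpperFirst X r →
  (∀ {a b} → Rep a → Rep b → a < b → Before X q a b) →
  (∀ {a b} → Rep a → Rep b → a < b → Before X r a b) →
  ∀ y z → q y < q z → r y < r z
order-determined {X} {q} {r} inv Rep cover uq ur bq br y z lt = go (rep y) (rep z)
  where
  rep : ∀ y → ∃ λ m → Rep m × (m ≡ y ⊎ m ≡ X y)
  rep y with cover y
  ... | inj₁ p = y , p , inj₁ refl
  ... | inj₂ p = X y , p , inj₂ refl

  lift : ∀ {s m m′ y z} → m ≡ y ⊎ m ≡ X y → m′ ≡ z ⊎ m′ ≡ X z → Before X s m m′ → s y < s z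
  lift (inj₁ refl) (inj₁ refl) B = b₁ B
  lift (inj₁ refl) (inj₂ refl) B = b₁ (before-Xʳ inv B)
  lift (inj₂ refl) (inj₁ refl) B = b₁ (before-Xˡ inv B)
  lift (inj₂ refl) (inj₂ refl) B = b₁ (before-Xˡ inv (before-Xʳ inv B))

  partner : z ≡ X y → r y < r z
  partner refl with <-cmp y (X y)
  ... | tri< l _ _ = ⊥-elim (<-asym lt (uq l))
  ... | tri≈ _ e _ = ⊥-elim (<⇒≢ lt (cong q e))
  ... | tri> _ _ l = subst (λ t → r t < r (X y)) (inv y) (ur (subst (X y <_) (sym (inv y)) l))

  same : ∀ {m} → m ≡ y ⊎ m ≡ X y → m ≡ z ⊎ m ≡ X z → r y < r z
  same (inj₁ p) (inj₁ p′) = ⊥-elim (<⇒≢ lt (cong q (trans (sym p) p′)))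
  same (inj₁ p) (inj₂ p′) = partner (trans (sym (inv z)) (cong X (trans (sym p′) p)))
  same (inj₂ p) (inj₁ p′) = partner (trans (sym p′) p)
  same (inj₂ p) (inj₂ p′) = ⊥-elim (<⇒≢ lt (cong q (involutive⇒injective inv (trans (sym p) p′))))

  go : (∃ λ m → Rep m × (m ≡ y ⊎ m ≡ X y)) → (∃ λ m → Rep m × (m ≡ z ⊎ m ≡ X z)) → r y < r z
  go (m , p , e) (m′ , p′ , e′) with <-cmp m m′
  ... | tri< l _ _   = lift {r} e e′ (br p p′ l)
  ... | tri≈ _ refl _ = same e e′
  ... | tri> _ _ l   = ⊥-elim (<-asym lt (lift {q} e′ e (bq p′ p l)))

increasing⇒inflationary : ∀ {g : ℕ → ℕ} → (∀ j k → j < k → g j < g k) → ∀ k → k ≤ g k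
increasing⇒inflationary inc zero    = z≤n
increasing⇒inflationary inc (suc k) =
  ≤-<-trans (increasing⇒inflationary inc k) (inc k (suc k) (n<1+n k))

-- The maps q′ ∘ w and q ∘ w′ are mutually inverse and both increasing on ℕ. Neither can lower a
-- value, so both are the identity.
same-order⇒same-inverse : ∀ {q w q′ w′ : ℕ → ℕ} →
  (∀ k → q (w k) ≡ k) → (∀ a → w (q a) ≡ a) → (∀ k → q′ (w′ k) ≡ k) → (∀ a → w′ (q′ a) ≡ a) →
  (∀ y z → q y < q z → q′ y < q′ z) → (∀ y z → q′ y < q′ z → q y < q z) → ∀ k → w k ≡ w′ k
same-order⇒same-inverse {q} {w} {q′} {w′} qw wq qw′ wq′ f g k =
  trans (cong w (sym fixed)) (wq (w′ k))
  where
  f-inc : ∀ i j → i < j → q′ (w i) < q′ (w j)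
  f-inc i j lt = f _ _ (subst₂ _<_ (sym (qw i)) (sym (qw j)) lt)
  g-inc : ∀ i j → i < j → q (w′ i) < q (w′ j)
  g-inc i j lt = g _ _ (subst₂ _<_ (sym (qw′ i)) (sym (qw′ j)) lt)
  fixed : q (w′ k) ≡ k
  fixed = ≤-antisym
    (subst (q (w′ k) ≤_) (trans (cong q′ (wq (w′ k))) (qw′ k)) (increasing⇒inflationary f-inc (q (w′ k))))
    (increasing⇒inflationary g-inc k)

-- One-line notation, inverses and length

pos-here : ∀ x xs → pos x (x ∷ xs) ≡ 1
pos-here x xs with x ≡ᵇ x in eq
... | true  = refl
... | false = ⊥-elim (subst T eq (≡⇒≡ᵇ x x refl))

pos-there : ∀ {e x} → e ≢ x → ∀ xs → pos e (x ∷ xs) ≡ suc (pos e xs)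
pos-there {e} {x} e≢x xs with e ≡ᵇ x in eq
... | true  = ⊥-elim (e≢x (≡ᵇ⇒≡ e x (subst T (sym eq) tt)))
... | false = refl

at-zero : ∀ w → at w 0 ≡ 0
at-zero []      = refl
at-zero (_ ∷ _) = refl

pos-positive : ∀ {e w} → e ∈ w → 1 ≤ pos e w
pos-positive {e} {x ∷ xs} _ with e ≡ᵇ x
... | true  = s≤s z≤n
... | false = s≤s z≤n

pos-≤-length : ∀ {e w} → e ∈ w → pos e w ≤ length w
pos-≤-length {e} {x ∷ xs} e∈ with e ≟ x
... | yes refl rewrite pos-here e xs = s≤s z≤n
pos-≤-length {e} {x ∷ xs} (here p)  | no ne = ⊥-elim (ne p)
pos-≤-length {e} {x ∷ xs} (there m) | no ne rewrite pos-there ne xs = s≤s (pos-≤-length m)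

at-pos : ∀ {e w} → e ∈ w → at w (pos e w) ≡ e
at-pos {e} {x ∷ xs} e∈ with e ≟ x
... | yes refl rewrite pos-here e xs = refl
at-pos {e} {x ∷ xs} (here p)  | no ne = ⊥-elim (ne p)
at-pos {e} {x ∷ xs} (there m) | no ne rewrite pos-there ne xs
  with pos e xs | pos-positive m | at-pos m
... | suc k | _ | ih = ih

at-∈ : ∀ {w k} → 1 ≤ k → k ≤ length w → at w k ∈ w
at-∈ {x ∷ xs} {suc zero}    _ _        = here refl
at-∈ {x ∷ xs} {suc (suc k)} _ (s≤s le) = there (at-∈ (s≤s z≤n) le)

pos-at : ∀ {w k} → Unique w → 1 ≤ k → k ≤ length w → pos (at w k) w ≡ k
pos-at {x ∷ xs} {suc zero}    _       _ _        = pos-here x xs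
pos-at {x ∷ xs} {suc (suc k)} (p ∷ u) _ (s≤s le) =
  trans (pos-there (All.lookup p (at-∈ (s≤s z≤n) le) ∘ sym) xs)
        (cong suc (pos-at u (s≤s z≤n) le))

at-ext : ∀ w v → length w ≡ length v → (∀ k → 1 ≤ k → k ≤ length w → at w k ≡ at v k) → w ≡ v
at-ext []       []       _ _ = refl
at-ext (x ∷ xs) (y ∷ ys) e h = cong₂ _∷_ (h 1 (s≤s z≤n) (s≤s z≤n))
  (at-ext xs ys (suc-injective e) λ { (suc k) _ le → h (2 + k) (s≤s z≤n) (s≤s le) })

at-map : ∀ {f : ℕ → ℕ} → f 0 ≡ 0 → ∀ w k → at (map f w) k ≡ f (at w k)
at-map f0 []       k             = sym f0
at-map f0 (x ∷ xs) zero          = sym f0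
at-map f0 (x ∷ xs) (suc zero)    = refl
at-map f0 (x ∷ xs) (suc (suc k)) = at-map f0 xs (suc k)

at-map-range : ∀ (f g : ℕ → ℕ) {n k} → k < n → at (map f (map suc (applyUpTo g n))) (suc k) ≡ f (suc (g k))
at-map-range f g {suc n} {zero}  _        = refl
at-map-range f g {suc n} {suc k} (s≤s lt) = at-map-range f (g ∘ suc) lt

at-inv : ∀ {n} w {k} → 1 ≤ k → k ≤ n → at (inv n w) k ≡ pos k w
at-inv w {suc k} _ le = at-map-range (λ i → pos i w) id le

length-range : ∀ n → length (range n) ≡ n
length-range n = trans (length-map suc (upTo n)) (length-upTo n)

length-inv : ∀ n w → length (inv n w) ≡ n
length-inv n w = trans (length-map _ (range n)) (length-range n)

∈-range⁻ : ∀ {n e} → e ∈ range n → 1 ≤ e × e ≤ n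
∈-range⁻ e∈ with ∈-map⁻ suc e∈
... | _ , m , refl = s≤s z≤n , ∈-upTo⁻ m

∈-range⁺ : ∀ {n e} → 1 ≤ e → e ≤ n → e ∈ range n
∈-range⁺ {n} {suc e} _ le = ∈-map⁺ suc (∈-upTo⁺ le)

range-unique : ∀ n → Unique (range n)
range-unique n = Unique.map⁺ suc-injective (Unique.upTo⁺ n)

at-range : ∀ {n k} → 1 ≤ k → k ≤ n → at (range n) k ≡ k
at-range {n} {suc k} _ le = subst (λ v → at v (suc k) ≡ suc k) (map-id (range n)) (at-map-range id id le)

length-swapAt : ∀ i w → length (swapAt i w) ≡ length w
length-swapAt zero          []          = refl
length-swapAt zero          (x ∷ w)     = refl
length-swapAt (suc zero)    []          = refl
length-swapAt (suc zero)    (x ∷ [])    = refl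
length-swapAt (suc zero)    (x ∷ y ∷ w) = refl
length-swapAt (suc (suc i)) []          = refl
length-swapAt (suc (suc i)) (x ∷ w)     = cong suc (length-swapAt (suc i) w)

swapAt-↭ : ∀ i w → swapAt i w ↭ w
swapAt-↭ zero          []          = ↭-refl
swapAt-↭ zero          (x ∷ w)     = ↭-refl
swapAt-↭ (suc zero)    []          = ↭-refl
swapAt-↭ (suc zero)    (x ∷ [])    = ↭-refl
swapAt-↭ (suc zero)    (x ∷ y ∷ w) = swap y x ↭-refl
swapAt-↭ (suc (suc i)) []          = ↭-refl
swapAt-↭ (suc (suc i)) (x ∷ w)     = prep x (swapAt-↭ (suc i) w)

at-swapAt : ∀ i w → 1 ≤ i → i < length w → ∀ k → at (swapAt i w) k ≡ at w (sw i k)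
at-swapAt (suc zero)    (x ∷ y ∷ w) _ _ zero                = refl
at-swapAt (suc zero)    (x ∷ y ∷ w) _ _ (suc zero)          = refl
at-swapAt (suc zero)    (x ∷ y ∷ w) _ _ (suc (suc zero))    = refl
at-swapAt (suc zero)    (x ∷ y ∷ w) _ _ (suc (suc (suc k))) = refl
at-swapAt (suc zero)    (x ∷ [])    _ (s≤s ())
at-swapAt (suc (suc i)) (x ∷ w)     _ _        zero          = refl
at-swapAt (suc (suc i)) (x ∷ w)     _ _        (suc zero)    = refl
at-swapAt (suc (suc i)) (x ∷ w)     _ (s≤s lt) (suc (suc k)) = at-swapAt (suc i) w (s≤s z≤n) lt (suc k)

sw-zero : ∀ {i} → 1 ≤ i → sw i 0 ≡ 0
sw-zero {suc i} _ = refl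

sw-fix> : ∀ {i n a} → i < n → n < a → sw i a ≡ a
sw-fix> {i} i<n n<a = sw-other i (λ { refl → <-asym i<n n<a }) (λ { refl → <-irrefl refl (<-≤-trans n<a i<n) })

sw-≤ : ∀ {i n a} → i < n → a ≤ n → sw i a ≤ n
sw-≤ {i} {n} {a} i<n le with swView i a
... | left  rewrite sw-left i  = i<n
... | right rewrite sw-right i = <⇒≤ i<n
... | other p q rewrite sw-other i p q = le

-- The one-line notation of a permutation, extended by the identity outside {1,…,n}.
abstract
  ⟦_⟧ : List ℕ → ℕ → ℕ
  ⟦ w ⟧ a with a ≤? length w
  ... | yes _ = at w a
  ... | no  _ = a

  ⟦⟧-in : ∀ w {a} → a ≤ length w → ⟦ w ⟧ a ≡ at w a
  ⟦⟧-in w {a} le with a ≤? length w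
  ... | yes _ = refl
  ... | no nle = ⊥-elim (nle le)

  ⟦⟧-out : ∀ w {a} → length w < a → ⟦ w ⟧ a ≡ a
  ⟦⟧-out w {a} lt with a ≤? length w
  ... | yes le = ⊥-elim (<⇒≱ lt le)
  ... | no _ = refl

⟦⟧-zero : ∀ w → ⟦ w ⟧ 0 ≡ 0
⟦⟧-zero w = trans (⟦⟧-in w z≤n) (at-zero w)

-- The index 0 is kept apart: it is no position of a word, yet `⟦_⟧` fixes it, thanks to the default
-- value 0 of `at`.
data Location (n : ℕ) : ℕ → Set where
  zero    : Location n 0
  inside  : ∀ {a} → 1 ≤ a → a ≤ n → Location n a
  outside : ∀ {a} → n < a → Location n a

locate : ∀ n a → Location n a
locate n zero = zero
locate n (suc a) with suc a ≤? n
... | yes le = inside (s≤s z≤n) le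
... | no nle = outside (≰⇒> nle)

⟦⟧-ext : ∀ {w v} → length w ≡ length v → (∀ a → ⟦ w ⟧ a ≡ ⟦ v ⟧ a) → w ≡ v
⟦⟧-ext {w} {v} e h = at-ext w v e λ k _ le →
  trans (sym (⟦⟧-in w le)) (trans (h k) (⟦⟧-in v (subst (k ≤_) e le)))

⟦range⟧ : ∀ n a → ⟦ range n ⟧ a ≡ a
⟦range⟧ n a with locate n a
... | zero = ⟦⟧-zero (range n)
... | inside l u = trans (⟦⟧-in (range n) (subst (a ≤_) (sym (length-range n)) u)) (at-range l u)
... | outside l = ⟦⟧-out (range n) (subst (_< a) (sym (length-range n)) l)

⟦swapAt⟧ : ∀ {i w} → 1 ≤ i → i < length w → ∀ a → ⟦ swapAt i w ⟧ a ≡ ⟦ w ⟧ (sw i a)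
⟦swapAt⟧ {i} {w} 1≤i i<n a with a ≤? length w
... | yes le = begin
  ⟦ swapAt i w ⟧ a   ≡⟨ ⟦⟧-in (swapAt i w) (subst (a ≤_) (sym (length-swapAt i w)) le) ⟩
  at (swapAt i w) a  ≡⟨ at-swapAt i w 1≤i i<n a ⟩
  at w (sw i a)      ≡⟨ ⟦⟧-in w (sw-≤ i<n le) ⟨
  ⟦ w ⟧ (sw i a)     ∎
  where open ≡-Reasoning
... | no nle rewrite sw-fix> i<n (≰⇒> nle) =
  trans (⟦⟧-out (swapAt i w) (subst (_< a) (sym (length-swapAt i w)) (≰⇒> nle)))
        (sym (⟦⟧-out w (≰⇒> nle)))

⟦map-sw⟧ : ∀ {i w} → 1 ≤ i → i < length w → ∀ a → ⟦ map (sw i) w ⟧ a ≡ sw i (⟦ w ⟧ a)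
⟦map-sw⟧ {i} {w} 1≤i i<n a with a ≤? length w
... | yes le = begin
  ⟦ map (sw i) w ⟧ a   ≡⟨ ⟦⟧-in (map (sw i) w) (subst (a ≤_) (sym (length-map (sw i) w)) le) ⟩
  at (map (sw i) w) a  ≡⟨ at-map (sw-zero 1≤i) w a ⟩
  sw i (at w a)        ≡⟨ cong (sw i) (⟦⟧-in w le) ⟨
  sw i (⟦ w ⟧ a)       ∎
  where open ≡-Reasoning
... | no nle = begin
  ⟦ map (sw i) w ⟧ a   ≡⟨ ⟦⟧-out (map (sw i) w) (subst (_< a) (sym (length-map (sw i) w)) (≰⇒> nle)) ⟩
  a                    ≡⟨ sw-fix> i<n (≰⇒> nle) ⟨
  sw i a               ≡⟨ cong (sw i) (⟦⟧-out w (≰⇒> nle)) ⟨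
  sw i (⟦ w ⟧ a)       ∎
  where open ≡-Reasoning

unique-map : ∀ {f : ℕ → ℕ} {xs} → (∀ {a b} → a ∈ xs → b ∈ xs → f a ≡ f b → a ≡ b) →
             Unique xs → Unique (map f xs)
unique-map {xs = []}     h []      = []
unique-map {xs = x ∷ xs} h (p ∷ u) =
  All.map⁺ (All.tabulate (λ m e → All.lookup p m (h (here refl) (there m) e)))
  ∷ unique-map (λ a b → h (there a) (there b)) u

unique∧set⇒perm : ∀ {n w} → Unique w → (∀ {e} → e ∈ w ⇔ (1 ≤ e × e ≤ n)) → IsPerm n w
unique∧set⇒perm {n} u h = ∼bag⇒↭ (unique∧set⇒bag u (range-unique n) (mk⇔
    (λ e∈ → let l , r = Equivalence.to h e∈ in ∈-range⁺ l r)
    (λ e∈ → Equivalence.from h (∈-range⁻ e∈))))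

module Perm {n w} (p : IsPerm n w) where

  len : length w ≡ n
  len = trans (↭.↭-length p) (length-range n)

  uniq : Unique w
  uniq = ↭ₛ.Unique-resp-↭ (setoid ℕ) (↭⇒↭ₛ (↭-sym p)) (range-unique n)

  ∈⁻ : ∀ {e} → e ∈ w → 1 ≤ e × e ≤ n
  ∈⁻ e∈ = ∈-range⁻ (↭.∈-resp-↭ p e∈)

  ∈⁺ : ∀ {e} → 1 ≤ e → e ≤ n → e ∈ w
  ∈⁺ l u = ↭.∈-resp-↭ (↭-sym p) (∈-range⁺ l u)

  ≤len : ∀ {a} → a ≤ n → a ≤ length w
  ≤len {a} = subst (a ≤_) (sym len)

  at-bounds : ∀ {k} → 1 ≤ k → k ≤ n → 1 ≤ at w k × at w k ≤ n
  at-bounds l u = ∈⁻ (at-∈ l (≤len u))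

  ⟦⟧≡at : ∀ {a} → a ≤ n → ⟦ w ⟧ a ≡ at w a
  ⟦⟧≡at = ⟦⟧-in w ∘ ≤len

  ⟦⟧≡id : ∀ {a} → n < a → ⟦ w ⟧ a ≡ a
  ⟦⟧≡id {a} lt = ⟦⟧-out w (subst (_< a) (sym len) lt)

  ⟦inv⟧≡pos : ∀ {a} → 1 ≤ a → a ≤ n → ⟦ inv n w ⟧ a ≡ pos a w
  ⟦inv⟧≡pos {a} l u = trans (⟦⟧-in (inv n w) (subst (a ≤_) (sym (length-inv n w)) u)) (at-inv w l u)

  ⟦inv⟧≡id : ∀ {a} → n < a → ⟦ inv n w ⟧ a ≡ a
  ⟦inv⟧≡id {a} lt = ⟦⟧-out (inv n w) (subst (_< a) (sym (length-inv n w)) lt)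

  inv-left : ∀ a → ⟦ inv n w ⟧ (⟦ w ⟧ a) ≡ a
  inv-left a with locate n a
  ... | zero rewrite ⟦⟧-zero w = ⟦⟧-zero (inv n w)
  ... | outside l rewrite ⟦⟧≡id l = ⟦inv⟧≡id l
  ... | inside l u rewrite ⟦⟧≡at u =
    trans (⟦inv⟧≡pos (proj₁ (at-bounds l u)) (proj₂ (at-bounds l u))) (pos-at uniq l (≤len u))

  inv-right : ∀ a → ⟦ w ⟧ (⟦ inv n w ⟧ a) ≡ a
  inv-right a with locate n a
  ... | zero rewrite ⟦⟧-zero (inv n w) = ⟦⟧-zero w
  ... | outside l rewrite ⟦inv⟧≡id l = ⟦⟧≡id l
  ... | inside l u rewrite ⟦inv⟧≡pos l u = trans (⟦⟧-in w (pos-≤-length (∈⁺ l u))) (at-pos (∈⁺ l u))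

  ⟦⟧-injective : Injective ⟦ w ⟧
  ⟦⟧-injective {a} {b} e = trans (sym (inv-left a)) (trans (cong ⟦ inv n w ⟧ e) (inv-left b))

  inv-unique : ∀ {v} → length v ≡ n → (∀ a → ⟦ v ⟧ (⟦ w ⟧ a) ≡ a) → v ≡ inv n w
  inv-unique {v} lv h = ⟦⟧-ext (trans lv (sym (length-inv n w))) λ a →
    trans (cong ⟦ v ⟧ (sym (inv-right a))) (h (⟦ inv n w ⟧ a))

  inv-perm : IsPerm n (inv n w)
  inv-perm = unique∧set⇒perm
    (unique-map (λ a∈ b∈ e → trans (sym (at-pos (w∋ a∈))) (trans (cong (at w) e) (at-pos (w∋ b∈))))
      (range-unique n))
    (mk⇔ to from)
    where
    w∋ : ∀ {e} → e ∈ range n → e ∈ w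
    w∋ = ↭.∈-resp-↭ (↭-sym p)
    to : ∀ {e} → e ∈ inv n w → 1 ≤ e × e ≤ n
    to e∈ with ∈-map⁻ _ e∈
    ... | _ , m , refl = pos-positive (w∋ m) , subst (_ ≤_) len (pos-≤-length (w∋ m))
    from : ∀ {e} → 1 ≤ e × e ≤ n → e ∈ inv n w
    from (l , u) = subst (_∈ inv n w) (pos-at uniq l (≤len u))
      (∈-map⁺ (λ i → pos i w) (↭.∈-resp-↭ p (at-∈ l (≤len u))))

  swapAt-perm : ∀ i → IsPerm n (swapAt i w)
  swapAt-perm i = ↭-trans (swapAt-↭ i w) p

  ⟦swap⟧ : ∀ {i} → 1 ≤ i → i < n → ∀ a → ⟦ swapAt i w ⟧ a ≡ ⟦ w ⟧ (sw i a)
  ⟦swap⟧ {i} l u = ⟦swapAt⟧ l (subst (i <_) (sym len) u)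

  ⟦map⟧ : ∀ {i} → 1 ≤ i → i < n → ∀ a → ⟦ map (sw i) w ⟧ a ≡ sw i (⟦ w ⟧ a)
  ⟦map⟧ {i} l u = ⟦map-sw⟧ l (subst (i <_) (sym len) u)

range-perm : ∀ n → IsPerm n (range n)
range-perm n = ↭-refl

map-sw-perm : ∀ {n w i} → IsPerm n w → 1 ≤ i → i < n → IsPerm n (map (sw i) w)
map-sw-perm {n} {w} {i} p l u = ↭-trans (↭.map⁺ (sw i) p)
  (↭-trans (↭-reflexive map≡swap) (swapAt-↭ i (range n)))
  where
  module R = Perm (range-perm n)
  map≡swap : map (sw i) (range n) ≡ swapAt i (range n)
  map≡swap = ⟦⟧-ext (trans (length-map (sw i) (range n)) (sym (length-swapAt i (range n)))) λ a →
    trans (R.⟦map⟧ l u a) (trans (cong (sw i) (⟦range⟧ n a))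
      (sym (trans (R.⟦swap⟧ l u a) (⟦range⟧ n (sw i a)))))

inv-involutive : ∀ {n w} → IsPerm n w → inv n (inv n w) ≡ w
inv-involutive {n} {w} p = sym (I.inv-unique W.len W.inv-right)
  where
  module W = Perm p
  module I = Perm W.inv-perm

inv-swapAt : ∀ {n w i} → IsPerm n w → 1 ≤ i → i < n → inv n (swapAt i w) ≡ map (sw i) (inv n w)
inv-swapAt {n} {w} {i} p l u = sym (S.inv-unique (trans (length-map (sw i) (inv n w)) (length-inv n w)) λ a →
  trans (I.⟦map⟧ l u (⟦ swapAt i w ⟧ a)) (trans (cong (λ t → sw i (⟦ inv n w ⟧ t)) (W.⟦swap⟧ l u a))
    (trans (cong (sw i) (W.inv-left (sw i a))) (sw-involutive i a))))
  where
  module W = Perm p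
  module S = Perm (W.swapAt-perm i)
  module I = Perm W.inv-perm

-- Length under exchange of adjacent positions or adjacent values

<ᵇ-true : ∀ {m n} → m < n → (m <ᵇ n) ≡ true
<ᵇ-true {m} {n} lt with m <ᵇ n | <⇒<ᵇ lt
... | true | _ = refl

<ᵇ-false : ∀ {m n} → ¬ m < n → (m <ᵇ n) ≡ false
<ᵇ-false {m} {n} nlt with m <ᵇ n in eq
... | true  = ⊥-elim (nlt (<ᵇ⇒< m n (subst T (sym eq) tt)))
... | false = refl

<ᵇ-cong : ∀ {a b c d} → (a < b → c < d) → (c < d → a < b) → (a <ᵇ b) ≡ (c <ᵇ d)
<ᵇ-cong {a} {b} f g with a <? b
... | yes l = trans (<ᵇ-true l) (sym (<ᵇ-true (f l)))
... | no n  = trans (<ᵇ-false n) (sym (<ᵇ-false (n ∘ g)))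

swap-sum : ∀ a b c → a + (b + c) ≡ b + (a + c)
swap-sum a b c = trans (sym (+-assoc a b c)) (trans (cong (_+ c) (+-comm a b)) (+-assoc b a c))

countLess-↭ : ∀ x {v w} → v ↭ w → countLess x v ≡ countLess x w
countLess-↭ x _↭_.refl = refl
countLess-↭ x (prep y p) = cong ((if y <ᵇ x then 1 else 0) +_) (countLess-↭ x p)
countLess-↭ x (swap {_} {w} y z p) rewrite countLess-↭ x p =
  swap-sum (if y <ᵇ x then 1 else 0) (if z <ᵇ x then 1 else 0) (countLess x w)
countLess-↭ x (_↭_.trans p q) = trans (countLess-↭ x p) (countLess-↭ x q)

ℓ-swapAt : ∀ i w → 1 ≤ i → i < length w → at w i < at w (suc i) → ℓ (swapAt i w) ≡ suc (ℓ w)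
ℓ-swapAt (suc zero) (x ∷ []) _ (s≤s ()) _
ℓ-swapAt (suc zero) (x ∷ y ∷ w) _ _ lt
  rewrite <ᵇ-true lt | <ᵇ-false (<-asym lt) =
  cong suc (swap-sum c d (ℓ w))
  where
  c = countLess y w
  d = countLess x w
ℓ-swapAt (suc (suc i)) (x ∷ w) _ (s≤s u) lt =
  trans (cong₂ _+_ (countLess-↭ x (swapAt-↭ (suc i) w)) (ℓ-swapAt (suc i) w (s≤s z≤n) u lt))
        (+-suc (countLess x w) (ℓ w))

countLess-sw-other : ∀ i {x} → x ≢ i → x ≢ suc i → ∀ w → countLess x (map (sw i) w) ≡ countLess x w
countLess-sw-other i p q [] = refl
countLess-sw-other i {x} p q (y ∷ w) = cong₂ (λ b c → (if b then 1 else 0) + c)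
  (<ᵇ-cong from to) (countLess-sw-other i p q w)
  where
  sx : sw i x ≡ x
  sx = sw-other i p q
  from : sw i y < x → y < x
  from l with sw-<⁻ i (subst (sw i y <_) (sym sx) l)
  ... | inj₁ m = m
  ... | inj₂ (_ , e) = ⊥-elim (p e)
  to : y < x → sw i y < x
  to l with sw-< i l
  ... | inj₁ m = subst (sw i y <_) sx m
  ... | inj₂ (_ , e) = ⊥-elim (q e)

countLess-sw-left : ∀ i w → i ∉ w → suc i ∉ w → countLess (suc i) (map (sw i) w) ≡ countLess i w
countLess-sw-left i [] _ _ = refl
countLess-sw-left i (y ∷ w) p q
  rewrite sw-other i {y} (λ e → p (here (sym e))) (λ e → q (here (sym e))) =
  cong₂ (λ b c → (if b then 1 else 0) + c)
    (<ᵇ-cong (λ l → ≤∧≢⇒< (s≤s⁻¹ l) (λ e → p (here (sym e)))) m<n⇒m<1+n)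
    (countLess-sw-left i w (p ∘ there) (q ∘ there))

-- The one new inversion: the entry i, renamed i + 1, now exceeds the former i + 1 to its right.
-- Every other entry of w compares alike with i and i + 1.
countLess-sw-left∈ : ∀ i w → Unique w → i ∉ w → suc i ∈ w →
                     countLess (suc i) (map (sw i) w) ≡ suc (countLess i w)
countLess-sw-left∈ i (y ∷ w) (h ∷ u) p (here refl)
  rewrite sw-right i | <ᵇ-true (n<1+n i) | <ᵇ-false (<-asym (n<1+n i)) =
  cong suc (countLess-sw-left i w (p ∘ there) (λ m → All.lookup h m refl))
countLess-sw-left∈ i (y ∷ w) (h ∷ u) p (there m)
  rewrite sw-other i {y} (λ e → p (here (sym e))) (λ e → All.lookup h m e) =
  trans (cong₂ (λ b c → (if b then 1 else 0) + c)
          (<ᵇ-cong (λ l → ≤∧≢⇒< (s≤s⁻¹ l) (λ e → p (here (sym e)))) m<n⇒m<1+n)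
          (countLess-sw-left∈ i w u (p ∘ there) m))
        (+-suc (if y <ᵇ i then 1 else 0) _)

countLess-sw-right : ∀ i w → i ∉ w → suc i ∉ w → countLess i (map (sw i) w) ≡ countLess (suc i) w
countLess-sw-right i [] _ _ = refl
countLess-sw-right i (y ∷ w) p q
  rewrite sw-other i {y} (λ e → p (here (sym e))) (λ e → q (here (sym e))) =
  cong₂ (λ b c → (if b then 1 else 0) + c)
    (<ᵇ-cong m<n⇒m<1+n (λ l → ≤∧≢⇒< (s≤s⁻¹ l) (λ e → p (here (sym e)))))
    (countLess-sw-right i w (p ∘ there) (q ∘ there))

ℓ-sw-without : ∀ i w → Unique w → i ∉ w → ℓ (map (sw i) w) ≡ ℓ w
ℓ-sw-without i [] _ _ = refl
ℓ-sw-without i (x ∷ w) (h ∷ u) p with swView i x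
... | left = ⊥-elim (p (here refl))
... | right rewrite sw-right i =
  cong₂ _+_ (countLess-sw-right i w (p ∘ there) (λ m → All.lookup h m refl)) (ℓ-sw-without i w u (p ∘ there))
... | other q r rewrite sw-other i q r =
  cong₂ _+_ (countLess-sw-other i q r w) (ℓ-sw-without i w u (p ∘ there))

-- The recursion stops at the entry i, where the new inversion arises; the rest of the word is free
-- of i, and renaming i + 1 there leaves its length unchanged.
ℓ-map-sw : ∀ i w → Unique w → i ∈ w → suc i ∈ w → pos i w < pos (suc i) w → ℓ (map (sw i) w) ≡ suc (ℓ w)
ℓ-map-sw i (x ∷ w) (h ∷ u) i∈ si∈ lt with swView i x
... | left rewrite sw-left i with si∈
...   | here e = ⊥-elim (1+n≢n e)
...   | there m = cong₂ _+_ (countLess-sw-left∈ i w u (λ m′ → All.lookup h m′ refl) m)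
                    (ℓ-sw-without i w u (λ m′ → All.lookup h m′ refl))
ℓ-map-sw i (x ∷ w) (h ∷ u) i∈ si∈ lt | right =
  ⊥-elim (<⇒≱ (subst (pos i (x ∷ w) <_) (pos-here x w) lt) (pos-positive i∈))
ℓ-map-sw i (x ∷ w) (h ∷ u) i∈ si∈ lt | other q r
  rewrite sw-other i q r | pos-there (q ∘ sym) w | pos-there (r ∘ sym) w =
  trans (cong₂ _+_ (countLess-sw-other i q r w)
          (ℓ-map-sw i w u (tail∈ q i∈) (tail∈ r si∈) (s≤s⁻¹ lt)))
        (+-suc (countLess x w) (ℓ w))
  where
  tail∈ : ∀ {e} → x ≢ e → e ∈ x ∷ w → e ∈ w
  tail∈ ne (here e)  = ⊥-elim (ne (sym e))
  tail∈ ne (there m) = m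

-- Demazure products

injective-cmp : ∀ {f} → Injective f → ∀ {a b} → a ≢ b → f a < f b ⊎ f b < f a
injective-cmp {f} inj {a} {b} ne with <-cmp (f a) (f b)
... | tri< l _ _ = inj₁ l
... | tri≈ _ e _ = ⊥-elim (ne (inj e))
... | tri> _ _ l = inj₂ l

-- The Demazure product s_i ∘ y, as demS y i is y ∘ s_i.
demL : ℕ → List ℕ → List ℕ
demL i y = if pos i y <ᵇ pos (suc i) y then map (sw i) y else y

module Adjacent {n y} (p : IsPerm n y) {i} (1≤i : 1 ≤ i) (i<n : i < n) where
  open Perm p

  private
    i<len : i < length y
    i<len = subst (i <_) (sym len) i<n

    to-at : ⟦ y ⟧ i < ⟦ y ⟧ (suc i) → at y i < at y (suc i)
    to-at = subst₂ _<_ (⟦⟧≡at (<⇒≤ i<n)) (⟦⟧≡at i<n)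

  swapAt-involutive : swapAt i (swapAt i y) ≡ y
  swapAt-involutive = ⟦⟧-ext (trans (length-swapAt i _) (length-swapAt i y)) λ a →
    trans (Perm.⟦swap⟧ (swapAt-perm i) 1≤i i<n a)
      (trans (⟦swap⟧ 1≤i i<n (sw i a)) (cong ⟦ y ⟧ (sw-involutive i a)))

  ⟦swap⟧-left : ⟦ swapAt i y ⟧ i ≡ ⟦ y ⟧ (suc i)
  ⟦swap⟧-left = trans (⟦swap⟧ 1≤i i<n i) (cong ⟦ y ⟧ (sw-left i))

  ⟦swap⟧-right : ⟦ swapAt i y ⟧ (suc i) ≡ ⟦ y ⟧ i
  ⟦swap⟧-right = trans (⟦swap⟧ 1≤i i<n (suc i)) (cong ⟦ y ⟧ (sw-right i))

  ℓ-up : ⟦ y ⟧ i < ⟦ y ⟧ (suc i) → ℓ (swapAt i y) ≡ suc (ℓ y)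
  ℓ-up l = ℓ-swapAt i y 1≤i i<len (to-at l)

  demS-up : ⟦ y ⟧ i < ⟦ y ⟧ (suc i) → demS y i ≡ swapAt i y
  demS-up l rewrite <ᵇ-true (subst (ℓ y <_) (sym (ℓ-up l)) (n<1+n (ℓ y))) = refl

  demL-up : ⟦ inv n y ⟧ i < ⟦ inv n y ⟧ (suc i) → demL i y ≡ map (sw i) y
  demL-up l rewrite <ᵇ-true (subst₂ _<_ (⟦inv⟧≡pos 1≤i (<⇒≤ i<n)) (⟦inv⟧≡pos (s≤s z≤n) i<n) l) = refl

  demL-down : ⟦ inv n y ⟧ (suc i) < ⟦ inv n y ⟧ i → demL i y ≡ y
  demL-down l rewrite <ᵇ-false (<-asym (subst₂ _<_ (⟦inv⟧≡pos (s≤s z≤n) i<n) (⟦inv⟧≡pos 1≤i (<⇒≤ i<n)) l)) = refl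

  ⟦inv-swap⟧ : ∀ a → ⟦ inv n (swapAt i y) ⟧ a ≡ sw i (⟦ inv n y ⟧ a)
  ⟦inv-swap⟧ a = trans (cong (λ v → ⟦ v ⟧ a) (inv-swapAt p 1≤i i<n)) (Perm.⟦map⟧ inv-perm 1≤i i<n a)

module _ {n y} (p : IsPerm n y) {i} (1≤i : 1 ≤ i) (i<n : i < n) where
  open Adjacent p 1≤i i<n
  private module S = Adjacent (Perm.swapAt-perm p i) 1≤i i<n

  ℓ-down : ⟦ y ⟧ (suc i) < ⟦ y ⟧ i → ℓ y ≡ suc (ℓ (swapAt i y))
  ℓ-down l = trans (cong ℓ (sym swapAt-involutive))
    (S.ℓ-up (subst₂ _<_ (sym ⟦swap⟧-left) (sym ⟦swap⟧-right) l))

  demS-down : ⟦ y ⟧ (suc i) < ⟦ y ⟧ i → demS y i ≡ y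
  demS-down l rewrite <ᵇ-false (<-asym (subst (ℓ (swapAt i y) <_) (sym (ℓ-down l)) (n<1+n _))) = refl

demS-perm : ∀ {n y} i → IsPerm n y → IsPerm n (demS y i)
demS-perm {y = y} i p with ℓ y <ᵇ ℓ (swapAt i y)
... | true  = Perm.swapAt-perm p i
... | false = p

-- The instance of associativity behind all later computations. Multiplying on one side keeps the
-- ascent or descent on the other, unless y maps j, j + 1 to i, i + 1 in this order; then s_i y = y
-- s_j, and both products equal it.
demL-demS : ∀ {n y i j} → IsPerm n y → 1 ≤ i → i < n → 1 ≤ j → j < n →
            demS (demL i y) j ≡ demL i (demS y j)
demL-demS {n} {y} {i} {j} p 1≤i i<n 1≤j j<n =
  cases (injective-cmp I.⟦⟧-injective (<⇒≢ (n<1+n i))) (injective-cmp Y.⟦⟧-injective (<⇒≢ (n<1+n j)))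
  where
  module Y = Perm p
  module I = Perm Y.inv-perm
  module L = Adjacent p 1≤i i<n
  module R = Adjacent p 1≤j j<n
  module M = Adjacent (map-sw-perm {i = i} p 1≤i i<n) 1≤j j<n
  module S = Adjacent (Y.swapAt-perm j) 1≤i i<n

  Z⇒Y : ∀ {a b} → ⟦ inv n y ⟧ a ≡ b → ⟦ y ⟧ b ≡ a
  Z⇒Y {a} e = trans (cong ⟦ y ⟧ (sym e)) (Y.inv-right a)

  Y⇒Z : ∀ {a b} → ⟦ y ⟧ a ≡ b → ⟦ inv n y ⟧ b ≡ a
  Y⇒Z {a} e = trans (cong ⟦ inv n y ⟧ (sym e)) (Y.inv-left a)

  map≡ : ∀ a → ⟦ map (sw i) y ⟧ a ≡ sw i (⟦ y ⟧ a)
  map≡ = Y.⟦map⟧ 1≤i i<n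

  commute : swapAt j (map (sw i) y) ≡ map (sw i) (swapAt j y)
  commute = ⟦⟧-ext
    (trans (length-swapAt j (map (sw i) y)) (trans (length-map (sw i) y) (trans (sym (length-swapAt j y)) (sym (length-map (sw i) (swapAt j y))))))
    λ a → trans (Perm.⟦swap⟧ (map-sw-perm {i = i} p 1≤i i<n) 1≤j j<n a)
      (trans (map≡ (sw j a)) (sym (trans (Perm.⟦map⟧ (Y.swapAt-perm j) 1≤i i<n a) (cong (sw i) (Y.⟦swap⟧ 1≤j j<n a)))))

  coincide : ⟦ y ⟧ j ≡ i → ⟦ y ⟧ (suc j) ≡ suc i → map (sw i) y ≡ swapAt j y
  coincide e f = ⟦⟧-ext (trans (length-map (sw i) y) (sym (length-swapAt j y))) λ a →
    trans (map≡ a) (trans (go (swView j a)) (sym (Y.⟦swap⟧ 1≤j j<n a)))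
    where
    go : ∀ {a} → SwView j a → sw i (⟦ y ⟧ a) ≡ ⟦ y ⟧ (sw j a)
    go left  rewrite sw-left j | e | f = sw-left i
    go right rewrite sw-right j | e | f = sw-right i
    go (other q r) rewrite sw-other j q r =
      sw-other i (λ h → q (Y.⟦⟧-injective (trans h (sym e)))) (λ h → r (Y.⟦⟧-injective (trans h (sym f))))

  cases : ⟦ inv n y ⟧ i < ⟦ inv n y ⟧ (suc i) ⊎ ⟦ inv n y ⟧ (suc i) < ⟦ inv n y ⟧ i →
          ⟦ y ⟧ j < ⟦ y ⟧ (suc j) ⊎ ⟦ y ⟧ (suc j) < ⟦ y ⟧ j →
          demS (demL i y) j ≡ demL i (demS y j)
  cases (inj₁ zl) (inj₁ yl) rewrite L.demL-up zl | R.demS-up yl with sw-< i yl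
  ... | inj₁ l = trans (M.demS-up (subst₂ _<_ (sym (map≡ j)) (sym (map≡ (suc j))) l))
                   (trans commute (sym (S.demL-up (subst₂ _<_ (sym (R.⟦inv-swap⟧ i)) (sym (R.⟦inv-swap⟧ (suc i))) zl′))))
    where
    zl′ : sw j (⟦ inv n y ⟧ i) < sw j (⟦ inv n y ⟧ (suc i))
    zl′ with sw-< j zl
    ... | inj₁ m = m
    ... | inj₂ (e , f) = ⊥-elim (<-asym (n<1+n i) (subst₂ _<_
            (trans (cong (sw i) (Z⇒Y e)) (sw-left i)) (trans (cong (sw i) (Z⇒Y f)) (sw-right i)) l))
  ... | inj₂ (e , f) = trans
      (demS-down (map-sw-perm {i = i} p 1≤i i<n) 1≤j j<n (subst₂ _<_
        (sym (trans (map≡ (suc j)) (trans (cong (sw i) f) (sw-right i))))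
        (sym (trans (map≡ j) (trans (cong (sw i) e) (sw-left i)))) (n<1+n i)))
      (trans (coincide e f) (sym (S.demL-down (subst₂ _<_
        (sym (trans (R.⟦inv-swap⟧ (suc i)) (trans (cong (sw j) (Y⇒Z f)) (sw-right j))))
        (sym (trans (R.⟦inv-swap⟧ i) (trans (cong (sw j) (Y⇒Z e)) (sw-left j)))) (n<1+n j)))))
  cases (inj₁ zl) (inj₂ yg) rewrite L.demL-up zl | demS-down p 1≤j j<n yg | L.demL-up zl with sw-< i yg
  ... | inj₁ l = demS-down (map-sw-perm {i = i} p 1≤i i<n) 1≤j j<n (subst₂ _<_ (sym (map≡ (suc j))) (sym (map≡ j)) l)
  ... | inj₂ (e , f) = ⊥-elim (<-asym (n<1+n j) (subst₂ _<_ (Y⇒Z e) (Y⇒Z f) zl))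
  cases (inj₂ zg) (inj₁ yl) rewrite L.demL-down zg | R.demS-up yl with sw-< j zg
  ... | inj₁ l = sym (S.demL-down (subst₂ _<_ (sym (R.⟦inv-swap⟧ (suc i))) (sym (R.⟦inv-swap⟧ i)) l))
  ... | inj₂ (e , f) = ⊥-elim (<-asym (n<1+n i) (subst₂ _<_ (Z⇒Y e) (Z⇒Y f) yl))
  cases (inj₂ zg) (inj₂ yg) rewrite L.demL-down zg | demS-down p 1≤j j<n yg = sym (L.demL-down zg)

-- Reduced words and induction along descents

Letters : ℕ → List ℕ → Set
Letters n = All (λ j → 1 ≤ j × j < n)

foldl-demS-perm : ∀ {n y} js → IsPerm n y → IsPerm n (foldl demS y js)
foldl-demS-perm []       p = p
foldl-demS-perm (j ∷ js) p = foldl-demS-perm js (demS-perm j p)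

foldl-demL : ∀ {n y i js} → IsPerm n y → 1 ≤ i → i < n → Letters n js →
             foldl demS (demL i y) js ≡ demL i (foldl demS y js)
foldl-demL p l u [] = refl
foldl-demL {js = j ∷ js} p l u ((l′ , u′) ∷ a) =
  trans (cong (λ v → foldl demS v js) (demL-demS p l u l′ u′)) (foldl-demL (demS-perm j p) l u a)

-- Unfolds the local `go`, so that the inductions below can speak of `firstDesc` alone.
firstDesc-∷ : ∀ x y r → firstDesc (x ∷ y ∷ r) ≡ (if y <ᵇ x then just 1 else Maybe.map suc (firstDesc (y ∷ r)))
firstDesc-∷ x y r = refl

firstDesc-just : ∀ w {i} → firstDesc w ≡ just i → 1 ≤ i × i < length w × at w (suc i) < at w i
firstDesc-just (x ∷ y ∷ r) {i} e =
  go (y <ᵇ x) refl (firstDesc (y ∷ r)) refl (trans (sym (firstDesc-∷ x y r)) e)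
  where
  go : ∀ b → (y <ᵇ x) ≡ b → ∀ m → firstDesc (y ∷ r) ≡ m → (if b then just 1 else Maybe.map suc m) ≡ just i →
       1 ≤ i × i < length (x ∷ y ∷ r) × at (x ∷ y ∷ r) (suc i) < at (x ∷ y ∷ r) i
  go true eq _ _ refl = s≤s z≤n , s≤s (s≤s z≤n) , <ᵇ⇒< y x (subst T (sym eq) _)
  go false _ (just j) eq refl with j | firstDesc-just (y ∷ r) eq
  ... | suc k | _ , u , d = s≤s z≤n , s≤s u , d

firstDesc-nothing : ∀ w → firstDesc w ≡ nothing → Linked _≤_ w
firstDesc-nothing []          _ = []
firstDesc-nothing (x ∷ [])    _ = [-]
firstDesc-nothing (x ∷ y ∷ r) e =
  go (y <ᵇ x) refl (firstDesc (y ∷ r)) (firstDesc-nothing (y ∷ r)) (trans (sym (firstDesc-∷ x y r)) e)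
  where
  go : ∀ b → (y <ᵇ x) ≡ b → ∀ m → (m ≡ nothing → Linked _≤_ (y ∷ r)) →
       (if b then just 1 else Maybe.map suc m) ≡ nothing → Linked _≤_ (x ∷ y ∷ r)
  go false eq nothing ih _ = ≮⇒≥ (λ l → subst T (trans (sym (<ᵇ-true l)) eq) _) ∷ ih refl

range-sorted : ∀ n → Linked _≤_ (range n)
range-sorted n = Linked.map⁺ (Linked.applyUpTo⁺₂ id n (λ i → s≤s (n≤1+n i)))

sorted-perm≡range : ∀ {n w} → IsPerm n w → Linked _≤_ w → w ≡ range n
sorted-perm≡range {n} p s = Pointwise-≡⇒≡ (↗↭↗⇒≋ ≤-totalOrder s (range-sorted n) (↭⇒↭ₛ p))

redWordF-nothing : ∀ f v → firstDesc v ≡ nothing → redWordF f v ≡ []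
redWordF-nothing zero    v e = refl
redWordF-nothing (suc f) v e rewrite e = refl

redWordF-just : ∀ f v {i} → firstDesc v ≡ just i → redWordF (suc f) v ≡ redWordF f (swapAt i v) ++ i ∷ []
redWordF-just f v e rewrite e = refl

-- The recursion of `redWord` as an induction principle, free of fuel: each stripped descent comes
-- with the resulting equation between reduced words.
data Sorting (n : ℕ) : List ℕ → Set where
  sorted  : redWord (range n) ≡ [] → Sorting n (range n)
  descent : ∀ {w} i → IsPerm n w → 1 ≤ i → i < n → ⟦ w ⟧ (suc i) < ⟦ w ⟧ i →
            redWord w ≡ redWord (swapAt i w) ++ i ∷ [] → Sorting n (swapAt i w) → Sorting n w

sorting : ∀ {n} k {w} → ℓ w ≡ k → IsPerm n w → Sorting n w
sorting {n} k {w} e p with firstDesc w in eq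
... | nothing = subst (Sorting n) (sym w≡) (sorted (redWordF-nothing (ℓ (range n)) (range n) (subst (λ v → firstDesc v ≡ nothing) w≡ eq)))
  where w≡ = sorted-perm≡range p (firstDesc-nothing w eq)
... | just i = next k e
  where
  spec = firstDesc-just w eq
  1≤i = proj₁ spec
  i<n = subst (i <_) (Perm.len p) (proj₁ (proj₂ spec))
  d : ⟦ w ⟧ (suc i) < ⟦ w ⟧ i
  d = subst₂ _<_ (sym (⟦⟧-in w (proj₁ (proj₂ spec)))) (sym (⟦⟧-in w (<⇒≤ (proj₁ (proj₂ spec))))) (proj₂ (proj₂ spec))
  ℓ≡ : ℓ w ≡ suc (ℓ (swapAt i w))
  ℓ≡ = ℓ-down p 1≤i i<n d
  next : ∀ k → ℓ w ≡ k → Sorting n w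
  next zero    e = ⊥-elim (0≢1+n (trans (sym e) ℓ≡))
  next (suc k) e = descent i p 1≤i i<n d
    -- A descent lowers the length by exactly one, so the remaining fuel is the length of
    -- `swapAt i w`.
    (trans (cong (λ m → redWordF m w) ℓ≡) (redWordF-just _ w eq))
    (sorting k (suc-injective (trans (sym ℓ≡) e)) (Perm.swapAt-perm p i))

redWord-letters : ∀ {n w} → Sorting n w → Letters n (redWord w)
redWord-letters (sorted e) rewrite e = []
redWord-letters (descent i p l u d e s) rewrite e = All.++⁺ (redWord-letters s) ((l , u) ∷ [])

-- The involution w⁻¹ ∘ w

abstract
  -- Abstract, so that `rewrite` and `with` meet the product as one opaque term; `square-def` opens
  -- it again.
  square : ℕ → List ℕ → List ℕ
  square n w = inv n w ○ w

  square-def : ∀ n w → square n w ≡ inv n w ○ w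
  square-def n w = refl

  square-range : ∀ {n} → redWord (range n) ≡ [] → square n (range n) ≡ range n
  square-range {n} e rewrite e = sym (Perm.inv-unique (range-perm n) (length-range n)
    (λ a → trans (⟦range⟧ n _) (⟦range⟧ n a)))

  square-perm : ∀ {n w} → IsPerm n w → IsPerm n (square n w)
  square-perm {n} {w} p = foldl-demS-perm (redWord w) (Perm.inv-perm p)

  -- With w = w′ s_i one letter longer than w′, also w⁻¹ = s_i ∘ w′⁻¹. Pulling this s_i out on the
  -- left leaves s_i ∘ (w′⁻¹ ∘ w′) ∘ s_i.
  square-descent : ∀ {n w i} → IsPerm n w → 1 ≤ i → i < n → ⟦ w ⟧ (suc i) < ⟦ w ⟧ i →
    redWord w ≡ redWord (swapAt i w) ++ i ∷ [] → Sorting n (swapAt i w) →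
    square n w ≡ demS (demL i (square n (swapAt i w))) i
  square-descent {n} {w} {i} p l u d e s rewrite e = begin
    foldl demS (inv n w) (js ++ i ∷ [])                  ≡⟨ foldl-++ demS (inv n w) js (i ∷ []) ⟩
    demS (foldl demS (inv n w) js) i                    ≡⟨ cong (λ v → demS (foldl demS v js) i) inv≡ ⟩
    demS (foldl demS (demL i (inv n w′)) js) i          ≡⟨ cong (λ v → demS v i) (foldl-demL P′.inv-perm l u (redWord-letters s)) ⟩
    demS (demL i (foldl demS (inv n w′) js)) i          ∎
    where
    open ≡-Reasoning
    w′ js : List ℕ
    w′ = swapAt i w
    js = redWord w′
    p′ : IsPerm n w′
    p′ = Perm.swapAt-perm p i
    module P′ = Perm p′
    module A  = Adjacent p l u
    inv≡ : inv n w ≡ demL i (inv n w′)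
    inv≡ = begin
      inv n w               ≡⟨ cong (inv n) A.swapAt-involutive ⟨
      inv n (swapAt i w′)   ≡⟨ inv-swapAt p′ l u ⟩
      map (sw i) (inv n w′) ≡⟨ Adjacent.demL-up P′.inv-perm l u
        (subst₂ _<_ (cong (λ v → ⟦ v ⟧ i) (sym (inv-involutive p′)))
                    (cong (λ v → ⟦ v ⟧ (suc i)) (sym (inv-involutive p′)))
          (subst₂ _<_ (sym A.⟦swap⟧-left) (sym A.⟦swap⟧-right) d)) ⟨
      demL i (inv n w′)     ∎

⟦square-range⟧ : ∀ {n} → redWord (range n) ≡ [] → ∀ a → ⟦ square n (range n) ⟧ a ≡ a
⟦square-range⟧ {n} e a = trans (cong (λ v → ⟦ v ⟧ a) (square-range e)) (⟦range⟧ n a)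

-- As y⁻¹ = y, left and right ascents at i agree. At a descent nothing changes. At an ascent the
-- product is s_i y s_i, except when i and i + 1 are fixed: then s_i y = y s_i, and the second
-- multiplication is idle.
module Twist {n y i} (p : IsPerm n y) (yy : Involutive ⟦ y ⟧) (1≤i : 1 ≤ i) (i<n : i < n) where
  private
    module Y = Perm p
    module A = Adjacent p 1≤i i<n
    module M = Adjacent (map-sw-perm {i = i} p 1≤i i<n) 1≤i i<n

  inv≡self : inv n y ≡ y
  inv≡self = sym (Y.inv-unique Y.len yy)

  private
    map≡ : ∀ a → ⟦ map (sw i) y ⟧ a ≡ sw i (⟦ y ⟧ a)
    map≡ = Y.⟦map⟧ 1≤i i<n

    demL≡ : ⟦ y ⟧ i < ⟦ y ⟧ (suc i) → demL i y ≡ map (sw i) y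
    demL≡ l = A.demL-up (subst (λ v → ⟦ v ⟧ i < ⟦ v ⟧ (suc i)) (sym inv≡self) l)

  twist-stay : ⟦ y ⟧ (suc i) < ⟦ y ⟧ i → demS (demL i y) i ≡ y
  twist-stay g = trans
    (cong (λ v → demS v i) (A.demL-down (subst (λ v → ⟦ v ⟧ (suc i) < ⟦ v ⟧ i) (sym inv≡self) g)))
    (demS-down p 1≤i i<n g)

  twist-merge : ⟦ y ⟧ i ≡ i → ⟦ y ⟧ (suc i) ≡ suc i → ∀ a → ⟦ demS (demL i y) i ⟧ a ≡ sw i (⟦ y ⟧ a)
  twist-merge e f a = trans (cong (λ v → ⟦ v ⟧ a)
    (trans (cong (λ v → demS v i) (demL≡ (subst₂ _<_ (sym e) (sym f) (n<1+n i))))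
      (demS-down (map-sw-perm {i = i} p 1≤i i<n) 1≤i i<n
        (subst₂ _<_ (sym (trans (map≡ (suc i)) (trans (cong (sw i) f) (sw-right i))))
                    (sym (trans (map≡ i) (trans (cong (sw i) e) (sw-left i)))) (n<1+n i)))))
    (map≡ a)

  twist-conj : ⟦ y ⟧ i < ⟦ y ⟧ (suc i) → ¬ (⟦ y ⟧ i ≡ i × ⟦ y ⟧ (suc i) ≡ suc i) →
               ∀ a → ⟦ demS (demL i y) i ⟧ a ≡ sw i (⟦ y ⟧ (sw i a))
  twist-conj l nf a with sw-< i l
  ... | inj₂ (e , f) = ⊥-elim (nf (e , f))
  ... | inj₁ l′ = trans (cong (λ v → ⟦ v ⟧ a)
    (trans (cong (λ v → demS v i) (demL≡ l))
      (M.demS-up (subst₂ _<_ (sym (map≡ i)) (sym (map≡ (suc i))) l′))))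
    (trans (Perm.⟦swap⟧ (map-sw-perm {i = i} p 1≤i i<n) 1≤i i<n a) (map≡ (sw i a)))

involutive-cong : ∀ {X Y : ℕ → ℕ} → (∀ a → Y a ≡ X a) → Involutive X → Involutive Y
involutive-cong {X} {Y} h inv a = trans (h (Y a)) (trans (cong X (h a)) (inv a))

sw-commute⇒involutive : ∀ {X} i → Involutive X → (∀ b → X (sw i b) ≡ sw i (X b)) → Involutive (λ a → sw i (X a))
sw-commute⇒involutive {X} i inv c a =
  trans (cong (sw i) (c (X a))) (trans (sw-involutive i _) (inv a))

merge-involutive : ∀ {X i} → Involutive X → X i ≡ i → X (suc i) ≡ suc i → Involutive (λ a → sw i (X a))
merge-involutive {X} {i} inv e f = sw-commute⇒involutive i inv (λ b → commutes (swView i b))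
  where
  commutes : ∀ {b} → SwView i b → X (sw i b) ≡ sw i (X b)
  commutes left  rewrite sw-left i | e | f = sym (sw-left i)
  commutes right rewrite sw-right i | f | e = sym (sw-right i)
  commutes {b} (other q r) rewrite sw-other i q r = sym (sw-other i
    (λ h → q (trans (sym (inv b)) (trans (cong X h) e)))
    (λ h → r (trans (sym (inv b)) (trans (cong X h) f))))

split-involutive : ∀ {X i} → Involutive X → X i ≡ suc i → Involutive (λ a → sw i (X a))
split-involutive {X} {i} inv e = sw-commute⇒involutive i inv (λ b → commutes (swView i b))
  where
  f : X (suc i) ≡ i
  f = trans (cong X (sym e)) (inv i)
  commutes : ∀ {b} → SwView i b → X (sw i b) ≡ sw i (X b)
  commutes left  rewrite sw-left i | e | f = sym (sw-right i)
  commutes right rewrite sw-right i | f | e = sym (sw-left i)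
  commutes {b} (other q r) rewrite sw-other i q r = sym (sw-other i
    (λ h → r (trans (sym (inv b)) (trans (cong X h) e)))
    (λ h → q (trans (sym (inv b)) (trans (cong X h) f))))

data TwistView (X : ℕ → ℕ) (i : ℕ) : Set where
  stay  : X (suc i) < X i → TwistView X i
  merge : X i ≡ i → X (suc i) ≡ suc i → TwistView X i
  conj  : X i < X (suc i) → ¬ (X i ≡ i × X (suc i) ≡ suc i) → TwistView X i

twistView : ∀ {X} → Injective X → ∀ i → TwistView X i
twistView {X} inj i with injective-cmp inj (<⇒≢ (n<1+n i))
... | inj₂ g = stay g
... | inj₁ l with X i ≟ i | X (suc i) ≟ suc i
...   | yes e | yes f = merge e f
...   | yes e | no nf = conj l (nf ∘ proj₂)
...   | no ne | _     = conj l (ne ∘ proj₁)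

square-involutive : ∀ {n w} → Sorting n w → Involutive ⟦ square n w ⟧
square-involutive (sorted e) = involutive-cong {id} (⟦square-range⟧ e) (λ _ → refl)
square-involutive {n} {w} (descent i p l u d e s) rewrite square-descent p l u d e s
  with square n (swapAt i w) | square-perm (Perm.swapAt-perm p i) | square-involutive s
... | y | py | yy = go (twistView (Perm.⟦⟧-injective py) i)
  where
  open Twist py yy l u
  go : TwistView ⟦ y ⟧ i → Involutive ⟦ demS (demL i y) i ⟧
  go (stay g) rewrite twist-stay g = yy
  go (merge a b) = involutive-cong {λ a → sw i (⟦ y ⟧ a)} (twist-merge a b) (merge-involutive {⟦ y ⟧} yy a b)
  go (conj a b) = involutive-cong {λ a → sw i (⟦ y ⟧ (sw i a))} (twist-conj a b) (Conjugate.conj-involutive {⟦ y ⟧} {id} yy i)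

atom-id : Atom id id
atom-id = record
  { upperFirst = λ l → ⊥-elim (<-irrefl refl l)
  ; noneInside = λ l₁ l₂ _ → ⊥-elim (<-asym l₁ l₂)
  ; ordered    = λ _ _ l _ → l
  }

-- The word v repeats the recursion but skips a letter that leaves the product unchanged, and from
-- then on it is shorter than w. In the other cases y has an ascent at i, so the atom v has one too,
-- and v and w grow by one together.
atom-square : ∀ {n w} → Sorting n w →
  ∃ λ v → IsPerm n v × Atom ⟦ square n w ⟧ ⟦ v ⟧ × (v ≡ w ⊎ ℓ v < ℓ w)
atom-square {n} (sorted e) = range n , range-perm n ,
  atom-cong (λ a → sym (⟦square-range⟧ e a)) (λ a → sym (⟦range⟧ n a)) atom-id , inj₁ refl
atom-square {n} {w} (descent i p l u d e s) rewrite square-descent p l u d e s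
  with square n (swapAt i w) | square-perm (Perm.swapAt-perm p i) | square-involutive s | atom-square s
... | y | py | yy | v , pv , A , v≤ = go (twistView (Perm.⟦⟧-injective py) i)
  where
  open Twist py yy l u
  module V = Perm pv

  ℓv< : ℓ v < ℓ w
  ℓv< = subst (ℓ v <_) (sym (ℓ-down p l u d))
    (s≤s ([ (λ { refl → ≤-refl }) , <⇒≤ ]′ v≤))

  ascent : ⟦ y ⟧ i < ⟦ y ⟧ (suc i) → ⟦ v ⟧ i < ⟦ v ⟧ (suc i)
  ascent lt = b₁ (cycles-ordered yy A (n<1+n i) lt)

  lifted : ⟦ y ⟧ i < ⟦ y ⟧ (suc i) → swapAt i v ≡ w ⊎ ℓ (swapAt i v) < ℓ w
  lifted lt = [ (λ v≡ → inj₁ (trans (cong (swapAt i) v≡) (Adjacent.swapAt-involutive p l u)))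
              , (λ lt′ → inj₂ (subst₂ _<_ (sym (Adjacent.ℓ-up pv l u (ascent lt))) (sym (ℓ-down p l u d)) (s≤s lt′))) ]′ v≤

  go : TwistView ⟦ y ⟧ i →
       ∃ λ v → IsPerm n v × Atom ⟦ demS (demL i y) i ⟧ ⟦ v ⟧ × (v ≡ w ⊎ ℓ v < ℓ w)
  go (stay g) rewrite twist-stay g = v , pv , A , inj₂ ℓv<
  go (merge a b) = swapAt i v , V.swapAt-perm i ,
    atom-cong (λ c → sym (twist-merge a b c)) (λ c → sym (V.⟦swap⟧ l u c)) (Conjugate.atom-merge yy i A a b) ,
    lifted (subst₂ _<_ (sym a) (sym b) (n<1+n i))
  go (conj a b) = swapAt i v , V.swapAt-perm i ,
    atom-cong (λ c → sym (twist-conj a b c)) (λ c → sym (V.⟦swap⟧ l u c)) (Conjugate.atom-conj-up yy i A a b) ,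
    lifted a

atom-of-id : ∀ {X} → Involutive X → Atom X id → ∀ a → X a ≡ a
atom-of-id {X} inv A a with <-cmp a (X a)
... | tri< l _ _ = ⊥-elim (<-asym l (upperFirst A l))
... | tri≈ _ e _ = sym e
... | tri> _ _ l = ⊥-elim (<-asym l (subst (_< X a) (inv a) (upperFirst A (subst (X a <_) (sym (inv a)) l))))

-- X varies in the induction: a descent of w at i is removed from X by splitting the cycle or by
-- conjugation. The induction identifies the result with the square of the shorter word, and the
-- twist by s_i restores X.
atom⇒square : ∀ {n w X} → Sorting n w → Involutive X → Atom X ⟦ w ⟧ → ∀ a → ⟦ square n w ⟧ a ≡ X a
atom⇒square {n} {X = X} (sorted e) inv A a =
  trans (⟦square-range⟧ e a) (sym (atom-of-id inv (atom-cong (λ _ → refl) (⟦range⟧ n) A) a))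
atom⇒square {n} {w} {X} (descent i p l u d e s) inv A a rewrite square-descent p l u d e s
  = go (X i ≟ suc i)
  where
  y = square n (swapAt i w)
  module W = Perm p
  open Twist (square-perm (W.swapAt-perm i)) (square-involutive s) l u

  -- An ascent of X at i would put i before i + 1 by `cycles-ordered`, against the descent of w.
  Xd : X (suc i) < X i
  Xd = [ (λ lt → ⊥-elim (<-asym d (b₁ (cycles-ordered inv A (n<1+n i) lt)))) , id ]′
         (injective-cmp {X} (involutive⇒injective {X} inv) (<⇒≢ (n<1+n i)))

  go : _ → ⟦ demS (demL i y) i ⟧ a ≡ X a
  go (yes f) = trans (twist-merge
      (trans (ih i) (trans (cong (sw i) f) (sw-right i)))
      (trans (ih (suc i)) (trans (cong (sw i) (trans (cong X (sym f)) (inv i))) (sw-left i))) a)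
    (trans (cong (sw i) (ih a)) (sw-involutive i (X a)))
    where
    ih : ∀ b → ⟦ y ⟧ b ≡ sw i (X b)
    ih = atom⇒square s (split-involutive {X} inv f)
      (atom-cong (λ _ → refl) (λ b → sym (W.⟦swap⟧ l u b)) (Conjugate.atom-split inv i A f))
  go (no nf) = trans (twist-conj
      (subst₂ _<_ (sym yi) (sym ysi) sw-lt)
      (λ (h , h′) → <-asym Xd (subst₂ _<_
        (sym (sw-injective i (trans (sym ysi) (trans h′ (sym (sw-left i))))))
        (sym (sw-injective i (trans (sym yi) (trans h (sym (sw-right i))))))
        (n<1+n i))) a)
    (trans (cong (sw i) (ih (sw i a)))
      (trans (sw-involutive i _) (cong X (sw-involutive i a))))
    where
    open Conjugate {X} {⟦ w ⟧} inv i using (conj-involutive; atom-conj-down)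
    ih : ∀ b → ⟦ y ⟧ b ≡ sw i (X (sw i b))
    ih = atom⇒square s conj-involutive
      (atom-cong (λ _ → refl) (λ b → sym (W.⟦swap⟧ l u b)) (atom-conj-down W.⟦⟧-injective A Xd nf d))
    yi : ⟦ y ⟧ i ≡ sw i (X (suc i))
    yi = trans (ih i) (cong (sw i ∘ X) (sw-left i))
    ysi : ⟦ y ⟧ (suc i) ≡ sw i (X i)
    ysi = trans (ih (suc i)) (cong (sw i ∘ X) (sw-right i))
    sw-lt : sw i (X (suc i)) < sw i (X i)
    sw-lt with sw-< i Xd
    ... | inj₁ m = m
    ... | inj₂ (_ , h) = ⊥-elim (nf h)

-- Steps of ≺A on one-line notation

at-++ : ∀ p s k → at (p ++ s) (suc k + length p) ≡ at s (suc k)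
at-++ []      s k = cong (at s ∘ suc) (+-identityʳ k)
at-++ (x ∷ p) s k rewrite +-suc k (length p) = at-++ p s k

swapAt-++ : ∀ p s k → swapAt (suc k + length p) (p ++ s) ≡ p ++ swapAt (suc k) s
swapAt-++ []      s k = cong (λ m → swapAt (suc m) s) (+-identityʳ k)
swapAt-++ (x ∷ p) s k rewrite +-suc k (length p) = cong (x ∷_) (swapAt-++ p s k)

split-at : ∀ k u → 2 + k < length u →
  ∃₂ λ p r → u ≡ p ++ at u (1 + k) ∷ at u (2 + k) ∷ at u (3 + k) ∷ r
split-at zero    (x ∷ y ∷ z ∷ r) _ = [] , r , refl
split-at zero    (x ∷ []) (s≤s ())
split-at zero    (x ∷ y ∷ []) (s≤s (s≤s ()))
split-at (suc k) (x ∷ u) (s≤s lt) with split-at k u lt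
... | p , r , e = x ∷ p , r , cong (x ∷_) e

step-↭ : ∀ {u v} → StepA u v → u ↭ v
step-↭ (step p q a b c _ _) = ↭.++⁺ˡ p (↭-trans (prep c (swap a b ↭-refl)) (swap c b ↭-refl))

ℓ-inv-swapAt : ∀ {n u i} → IsPerm n u → 1 ≤ i → i < n → ⟦ u ⟧ i < ⟦ u ⟧ (suc i) →
               ℓ (inv n (swapAt i u)) ≡ suc (ℓ (inv n u))
ℓ-inv-swapAt {n} {u} {i} p l h lt = trans (cong ℓ (inv-swapAt p l h))
  (ℓ-map-sw i (inv n u) I.uniq (I.∈⁺ l (<⇒≤ h)) (I.∈⁺ (s≤s z≤n) h)
    (subst₂ _<_ (pos≡ l (<⇒≤ h)) (pos≡ (s≤s z≤n) h) lt))
  where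
  module I = Perm (Perm.inv-perm p)
  pos≡ : ∀ {k} → 1 ≤ k → k ≤ n → ⟦ u ⟧ k ≡ pos k (inv n u)
  pos≡ {k} l h = trans (cong (λ v → ⟦ v ⟧ k) (sym (inv-involutive p))) (I.⟦inv⟧≡pos l h)

-- The step is factored through `u₁`, which reads c b a: exchanging a and b goes up by one in
-- length, exchanging c and b down by one. Positions start at 1, so c stands at `suc (length p)`.
module AtomStep {n} (p : List ℕ) (r : List ℕ) {a b c : ℕ}
                (a≤b : a ≤ b) (b≤c : b ≤ c) (pu : IsPerm n (p ++ c ∷ a ∷ b ∷ r)) where

  u v u₁ : List ℕ
  u = p ++ c ∷ a ∷ b ∷ r
  v = p ++ b ∷ c ∷ a ∷ r
  u₁ = swapAt (2 + length p) u

  k : ℕ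
  k = suc (length p)

  pv : IsPerm n v
  pv = ↭-trans (↭-sym (step-↭ (step p r a b c a≤b b≤c))) pu

  u₁≡ : u₁ ≡ p ++ c ∷ b ∷ a ∷ r
  u₁≡ = swapAt-++ p (c ∷ a ∷ b ∷ r) 1

  pu₁ : IsPerm n u₁
  pu₁ = Perm.swapAt-perm pu (2 + length p)

  module U  = Perm pu
  module U₁ = Perm pu₁
  module V  = Perm pv

  bound : suc k < n
  bound = subst (suc k <_) (trans (sym (length-++ p)) U.len)
    (subst (_≤ length p + (3 + length r)) (+-comm (length p) 3)
      (+-monoʳ-≤ (length p) (m≤m+n 3 (length r))))

  uc : ⟦ u ⟧ k ≡ c
  uc = trans (U.⟦⟧≡at (<⇒≤ (<-trans (n<1+n k) bound))) (at-++ p _ 0)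
  ua : ⟦ u ⟧ (suc k) ≡ a
  ua = trans (U.⟦⟧≡at (<⇒≤ bound)) (at-++ p _ 1)
  ub : ⟦ u ⟧ (2 + k) ≡ b
  ub = trans (U.⟦⟧≡at bound) (at-++ p _ 2)

  a<b : a < b
  a<b = ≤∧≢⇒< a≤b λ e → <⇒≢ (n<1+n (suc k)) (U.⟦⟧-injective (trans ua (trans e (sym ub))))
  b<c : b < c
  b<c = ≤∧≢⇒< b≤c λ e → <⇒≢ (m<n⇒m<1+n (n<1+n k)) (U.⟦⟧-injective (trans uc (trans (sym e) (sym ub))))

  u₁≡v : swapAt k u₁ ≡ v
  u₁≡v = trans (cong (swapAt k) u₁≡) (swapAt-++ p (c ∷ b ∷ a ∷ r) 0)

  module A₁ = Adjacent pu (s≤s z≤n) bound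
  module A₂ = Adjacent pu₁ (s≤s z≤n) (<-trans (n<1+n k) bound)

  inv≡ : ∀ e → ⟦ inv n v ⟧ e ≡ sw k (sw (suc k) (⟦ inv n u ⟧ e))
  inv≡ e = trans (cong (λ t → ⟦ inv n t ⟧ e) (sym u₁≡v))
    (trans (A₂.⟦inv-swap⟧ e) (cong (sw k) (A₁.⟦inv-swap⟧ e)))

  inv-at : ∀ {j e} → ⟦ u ⟧ j ≡ e → ⟦ inv n u ⟧ e ≡ j
  inv-at {j} h = trans (cong ⟦ inv n u ⟧ (sym h)) (U.inv-left j)

  module _ {X : ℕ → ℕ} (xx : Involutive X) where
    open Step {X} {⟦ inv n u ⟧} {⟦ inv n v ⟧} xx (Perm.⟦⟧-injective U.inv-perm) a<b b<c
      (inv-at uc) (inv-at ua) (inv-at ub) inv≡ public using (atom-up; atom-down)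

  ℓ-inv≡ : ℓ (inv n u) ≡ ℓ (inv n v)
  ℓ-inv≡ = suc-injective (begin
    suc (ℓ (inv n u))          ≡⟨ ℓ-inv-swapAt pu (s≤s z≤n) bound (subst₂ _<_ (sym ua) (sym ub) a<b) ⟨
    ℓ (inv n u₁)               ≡⟨ cong (λ t → ℓ (inv n t)) A₂.swapAt-involutive ⟨
    ℓ (inv n (swapAt k (swapAt k u₁))) ≡⟨ cong (λ t → ℓ (inv n (swapAt k t))) u₁≡v ⟩
    ℓ (inv n (swapAt k v))     ≡⟨ ℓ-inv-swapAt pv (s≤s z≤n) (<-trans (n<1+n k) bound) (subst₂ _<_ (sym vb) (sym vc) b<c) ⟩
    suc (ℓ (inv n v))          ∎)
    where
    open ≡-Reasoning
    vb : ⟦ v ⟧ k ≡ b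
    vb = trans (V.⟦⟧≡at (<⇒≤ (<-trans (n<1+n k) bound))) (at-++ p _ 0)
    vc : ⟦ v ⟧ (suc k) ≡ c
    vc = trans (V.⟦⟧≡at (<⇒≤ bound)) (at-++ p _ 1)

-- Entries are weighted by 2 ^ x because 2 ^ b + 2 ^ b < 2 ^ c + 2 ^ a for b < c, so that a step
-- c a b → b c a changes both weights strictly.
suffixWeight : List ℕ → ℕ
suffixWeight []      = 0
suffixWeight (x ∷ w) = sum (map (2 ^_) w) + suffixWeight w

-- An entry counts once for each entry to its right, in `suffixWeight` once for each entry to its
-- left. A step raises `suffixWeight` and lowers `prefixWeight`, so the search for an extremal word
-- ends in both directions.
prefixWeight : List ℕ → ℕ
prefixWeight []      = 0
prefixWeight (x ∷ w) = length w * 2 ^ x + prefixWeight w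

2^-convex : ∀ {a b c} → b < c → 2 ^ b + 2 ^ b < 2 ^ c + 2 ^ a
2^-convex {a} {b} {c} b<c = ≤-<-trans
  (subst (_≤ 2 ^ c) (cong (2 ^ b +_) (+-identityʳ (2 ^ b))) (^-monoʳ-≤ 2 b<c))
  (m<m+n (2 ^ c) (m^n>0 2 a))

suffixWeight-step : ∀ p r {a b c} → b < c → suffixWeight (p ++ c ∷ a ∷ b ∷ r) < suffixWeight (p ++ b ∷ c ∷ a ∷ r)
suffixWeight-step (x ∷ p) r {a} {b} {c} b<c rewrite
  sum-↭ (↭.map⁺ (2 ^_) (↭.++⁺ˡ p (↭-trans (prep c (swap a b (↭-refl {x = r}))) (swap c b ↭-refl)))) =
  +-monoʳ-< _ (suffixWeight-step p r b<c)
suffixWeight-step [] r {a} {b} {c} b<c = subst₂ _<_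
  (solve 4 (λ A B R M → (B :+ B) :+ (A :+ R :+ R :+ R :+ M) := (A :+ (B :+ R)) :+ ((B :+ R) :+ (R :+ M))) refl A B R M)
  (solve 4 (λ A C R M → (C :+ A) :+ (A :+ R :+ R :+ R :+ M) := (C :+ (A :+ R)) :+ ((A :+ R) :+ (R :+ M))) refl A C R M)
  (+-monoˡ-< (A + R + R + R + M) (2^-convex {a} b<c))
  where
  open +-*-Solver
  A = 2 ^ a
  B = 2 ^ b
  C = 2 ^ c
  R = sum (map (2 ^_) r)
  M = suffixWeight r

prefixWeight-step : ∀ p r {a b c} → b < c → prefixWeight (p ++ b ∷ c ∷ a ∷ r) < prefixWeight (p ++ c ∷ a ∷ b ∷ r)
prefixWeight-step (x ∷ p) r {a} {b} {c} b<c rewrite length-++ p {b ∷ c ∷ a ∷ r} | length-++ p {c ∷ a ∷ b ∷ r} =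
  +-monoʳ-< ((length p + (3 + length r)) * 2 ^ x) (prefixWeight-step p r b<c)
prefixWeight-step [] r {a} {b} {c} b<c = subst₂ _<_
  (solve 5 (λ A B C L M → (B :+ B) :+ (L :* B :+ (con 1 :+ L) :* C :+ L :* A :+ M)
    := (con 2 :+ L) :* B :+ ((con 1 :+ L) :* C :+ (L :* A :+ M))) refl A B C L M)
  (solve 5 (λ A B C L M → (C :+ A) :+ (L :* B :+ (con 1 :+ L) :* C :+ L :* A :+ M)
    := (con 2 :+ L) :* C :+ ((con 1 :+ L) :* A :+ (L :* B :+ M))) refl A B C L M)
  (+-monoˡ-< (L * B + (1 + L) * C + L * A + M) (2^-convex {a} b<c))
  where
  open +-*-Solver
  A = 2 ^ a
  B = 2 ^ b
  C = 2 ^ c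
  L = length r
  M = prefixWeight r

module _ {n u} (pu : IsPerm n u) where
  private module U = Perm pu

  ⟦⟧-≤ : ∀ {a} → a ≤ n → ⟦ u ⟧ a ≤ n
  ⟦⟧-≤ {zero}  _  = subst (_≤ n) (sym (⟦⟧-zero u)) z≤n
  ⟦⟧-≤ {suc a} le = subst (_≤ n) (sym (U.⟦⟧≡at le)) (proj₂ (U.at-bounds (s≤s z≤n) le))

  -- Both b c a and c a b fall from the first to the third place. The identity extension allows no
  -- such fall from 0 or to a place beyond n, so a pattern lies inside the word.
  fall-inside : ∀ k → ⟦ u ⟧ (2 + k) < ⟦ u ⟧ k → 1 ≤ k × 2 + k ≤ n
  fall-inside zero    l = ⊥-elim (n≮0 (subst (⟦ u ⟧ 2 <_) (⟦⟧-zero u) l))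
  fall-inside (suc k) l with 3 + k ≤? n
  ... | yes le = s≤s z≤n , le
  ... | no nle = ⊥-elim (<-irrefl refl (<-≤-trans (subst (_< ⟦ u ⟧ (suc k)) (U.⟦⟧≡id (≰⇒> nle)) l) small))
    where
    small : ⟦ u ⟧ (suc k) ≤ 3 + k
    small with suc k ≤? n
    ... | yes le = ≤-trans (⟦⟧-≤ le) (<⇒≤ (≰⇒> nle))
    ... | no nle′ = subst (_≤ 3 + k) (sym (U.⟦⟧≡id (≰⇒> nle′))) (≤-trans (n≤1+n (suc k)) (n≤1+n (2 + k)))

  split-fall : ∀ k → ⟦ u ⟧ (2 + k) < ⟦ u ⟧ k →
    ∃₂ λ p r → u ≡ p ++ ⟦ u ⟧ k ∷ ⟦ u ⟧ (1 + k) ∷ ⟦ u ⟧ (2 + k) ∷ r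
  split-fall zero    l with () ← proj₁ (fall-inside zero l)
  split-fall (suc k) l
    rewrite U.⟦⟧≡at (proj₂ (fall-inside (suc k) l))
          | U.⟦⟧≡at (<⇒≤ (proj₂ (fall-inside (suc k) l)))
          | U.⟦⟧≡at (<⇒≤ (<⇒≤ (proj₂ (fall-inside (suc k) l)))) =
    split-at k u (U.≤len (proj₂ (fall-inside (suc k) l)))

  k<n : ∀ {k} → 2 + k ≤ n → k < n
  k<n le = <-trans (n<1+n _) le

  -- Because of `fall-inside`, a search below n settles the pattern for all positions in ℕ.
  step-before : (∃ λ v → StepA v u × suffixWeight v < suffixWeight u) ⊎ NoBCA ⟦ u ⟧
  step-before with anyUpTo? (λ k → (⟦ u ⟧ (2 + k) <? ⟦ u ⟧ k) ×-dec (⟦ u ⟧ k <? ⟦ u ⟧ (1 + k))) n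
  ... | no none = inj₂ λ k l₁ l₂ → none (k , k<n (proj₂ (fall-inside k l₁)) , l₁ , l₂)
  ... | yes (k , _ , l₁ , l₂) with split-fall k l₁
  ...   | p , r , e = inj₁ (p ++ ⟦ u ⟧ (1 + k) ∷ ⟦ u ⟧ (2 + k) ∷ ⟦ u ⟧ k ∷ r ,
            subst (StepA _) (sym e) (step p r _ _ _ (<⇒≤ l₁) (<⇒≤ l₂)) ,
            subst (λ t → suffixWeight (p ++ ⟦ u ⟧ (1 + k) ∷ ⟦ u ⟧ (2 + k) ∷ ⟦ u ⟧ k ∷ r) < suffixWeight t)
              (sym e) (suffixWeight-step p r l₂))

  step-after : (∃ λ v → StepA u v × prefixWeight v < prefixWeight u) ⊎ NoCAB ⟦ u ⟧
  step-after with anyUpTo? (λ k → (⟦ u ⟧ (1 + k) <? ⟦ u ⟧ (2 + k)) ×-dec (⟦ u ⟧ (2 + k) <? ⟦ u ⟧ k)) n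
  ... | no none = inj₂ λ k l₁ l₂ → none (k , k<n (proj₂ (fall-inside k l₂)) , l₁ , l₂)
  ... | yes (k , _ , l₁ , l₂) with split-fall k l₂
  ...   | p , r , e = inj₁ (p ++ ⟦ u ⟧ (2 + k) ∷ ⟦ u ⟧ k ∷ ⟦ u ⟧ (1 + k) ∷ r ,
            subst (λ t → StepA t (p ++ ⟦ u ⟧ (2 + k) ∷ ⟦ u ⟧ k ∷ ⟦ u ⟧ (1 + k) ∷ r)) (sym e) (step p r _ _ _ (<⇒≤ l₁) (<⇒≤ l₂)) ,
            subst (λ t → prefixWeight (p ++ ⟦ u ⟧ (2 + k) ∷ ⟦ u ⟧ k ∷ ⟦ u ⟧ (1 + k) ∷ r) < prefixWeight t)
              (sym e) (prefixWeight-step p r l₂))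

-- The words 0̂(x) and 1̂(x)

-- A statement about first occurrences, which are the ones that `dedup` keeps; z itself may be
-- absent.
data Precedes (y z : ℕ) : List ℕ → Set where
  here  : ∀ {s} → y ≢ z → Precedes y z (y ∷ s)
  there : ∀ {x s} → x ≢ z → Precedes y z s → Precedes y z (x ∷ s)

precedes⇒pos< : ∀ {y z s} → Precedes y z s → z ∈ s → pos y s < pos z s
precedes⇒pos< {y} {z} {y ∷ s} (here ne) z∈ rewrite pos-here y s | pos-there {z} {y} (ne ∘ sym) s =
  s≤s (tail-positive z∈)
  where
  tail-positive : z ∈ y ∷ s → 1 ≤ pos z s
  tail-positive (here e)  = ⊥-elim (ne (sym e))
  tail-positive (there m) = pos-positive m
precedes⇒pos< (there ne P) (here e) = ⊥-elim (ne (sym e))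
precedes⇒pos< {y} {z} {x ∷ s} (there ne P) (there m) rewrite pos-there {z} {x} (ne ∘ sym) s with y ≟ x
... | yes refl rewrite pos-here y s = s≤s (pos-positive m)
... | no y≢x rewrite pos-there y≢x s = s≤s (precedes⇒pos< P m)

precedes-filter : ∀ {y z x s} → x ≢ y → Precedes y z s → Precedes y z (filter (¬? ∘ (x ≟_)) s)
precedes-filter {y} {z} {x} x≢y (here {s} ne) rewrite filter-accept (¬? ∘ (x ≟_)) {xs = s} x≢y = here ne
precedes-filter {y} {z} {x} x≢y (there {t} {s} ne P) with x ≟ t
... | yes e  rewrite filter-reject (¬? ∘ (x ≟_)) {xs = s} (λ ne′ → ne′ e) = precedes-filter x≢y P
... | no x≢t rewrite filter-accept (¬? ∘ (x ≟_)) {xs = s} x≢t = there ne (precedes-filter x≢y P)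

precedes-dedup : ∀ {y z s} → Precedes y z s → Precedes y z (dedup s)
precedes-dedup (here ne) = here ne
precedes-dedup {y} (there {x} ne P) with x ≟ y
... | yes refl = here ne
... | no x≢y   = there ne (precedes-filter x≢y (precedes-dedup P))

-- The common shape of 0̂ and 1̂ before deduplication: the block of a kept a reads `h a`, `g a`.
blocks : (ℕ → Bool) → (ℕ → ℕ) → (ℕ → ℕ) → List ℕ → List ℕ
blocks keep g h xs = flipPairs (concatMap (λ a → if keep a then (g a , h a) ∷ [] else []) xs)

module Blocks (keep : ℕ → Bool) (g h : ℕ → ℕ) where

  ∈-blocks⁺ : ∀ {a z xs} → a ∈ xs → T (keep a) → z ≡ h a ⊎ z ≡ g a → z ∈ blocks keep g h xs
  ∈-blocks⁺ {a} (here refl) t o with keep a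
  ∈-blocks⁺ (here refl) t (inj₁ e) | true = here e
  ∈-blocks⁺ (here refl) t (inj₂ e) | true = there (here e)
  ∈-blocks⁺ {xs = x ∷ xs} (there m) t o with keep x
  ... | true  = there (there (∈-blocks⁺ m t o))
  ... | false = ∈-blocks⁺ m t o

  ∈-blocks⁻ : ∀ {z} xs → z ∈ blocks keep g h xs → ∃ λ a → a ∈ xs × T (keep a) × (z ≡ h a ⊎ z ≡ g a)
  ∈-blocks⁻ (x ∷ xs) z∈ with keep x in eq
  ∈-blocks⁻ (x ∷ xs) (here e)         | true = x , here refl , subst T (sym eq) tt , inj₁ e
  ∈-blocks⁻ (x ∷ xs) (there (here e)) | true = x , here refl , subst T (sym eq) tt , inj₂ e
  ∈-blocks⁻ (x ∷ xs) (there (there m)) | true with ∈-blocks⁻ xs m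
  ... | a , m′ , r = a , there m′ , r
  ∈-blocks⁻ (x ∷ xs) m | false with ∈-blocks⁻ xs m
  ... | a , m′ , r = a , there m′ , r

  -- Earlier blocks are harmless as soon as they avoid z, even if they contain y; the block of a
  -- then decides.
  precedes-blocks : ∀ {a y z xs} → AllPairs _<_ xs → a ∈ xs → T (keep a) →
    (∀ {x} → x < a → T (keep x) → h x ≢ z × g x ≢ z) →
    (∀ s → Precedes y z (h a ∷ g a ∷ s)) →
    Precedes y z (blocks keep g h xs)
  precedes-blocks {a} (_ ∷ _) (here refl) t H P with keep a
  ... | true = P _
  precedes-blocks {xs = x ∷ _} (p ∷ ps) (there m) t H P with keep x in eq
  ... | false = precedes-blocks ps m t H P
  ... | true with H (All.lookup p m) (subst T (sym eq) tt)
  ...   | ne , ne′ = there ne (there ne′ (precedes-blocks ps m t H P))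

range-increasing : ∀ n → AllPairs _<_ (range n)
range-increasing n = AllPairs.map⁺ (AllPairs.applyUpTo⁺₁ id n (λ l _ → s≤s l))

module Hats {n x} (p : IsPerm n x) (xx : Involutive ⟦ x ⟧) where
  open Perm p

  X : ℕ → ℕ
  X = ⟦ x ⟧

  X-bounds : ∀ {a} → 1 ≤ a → a ≤ n → 1 ≤ X a × X a ≤ n
  X-bounds l u = subst (λ z → 1 ≤ z × z ≤ n) (sym (⟦⟧≡at u)) (at-bounds l u)

  X-positive : ∀ {a} → 1 ≤ a → a ≤ n → 1 ≤ X a
  X-positive l u = proj₁ (X-bounds l u)

  X-≤ : ∀ {a} → 1 ≤ a → a ≤ n → X a ≤ n
  X-≤ l u = proj₂ (X-bounds l u)

  inside-of-moved : ∀ {a} → a ≢ X a → 1 ≤ a × a ≤ n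
  inside-of-moved {a} ne with locate n a
  ... | zero       = ⊥-elim (ne (sym (⟦⟧-zero x)))
  ... | inside l u = l , u
  ... | outside l  = ⊥-elim (ne (sym (⟦⟧≡id l)))

  X-sym : ∀ {a b} → X a ≡ b → X b ≡ a
  X-sym {a} e = trans (cong X (sym e)) (xx a)

  -- `values` makes each block a cycle of x, in one of its two orders, and `covers` keeps every
  -- cycle at one of its ends; together they make the deduplicated word a permutation.
  module Hat (keep : ℕ → Bool) (g h : ℕ → ℕ)
    (values : ∀ {a} → 1 ≤ a → a ≤ n → (h a ≡ a × g a ≡ X a) ⊎ (h a ≡ X a × g a ≡ a))
    (covers : ∀ {a} → 1 ≤ a → a ≤ n → T (keep a) ⊎ T (keep (X a))) where

    open Blocks keep g h

    hat : List ℕ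
    hat = dedup (blocks keep g h (range n))

    hat-∈⁺ : ∀ {e} → 1 ≤ e → e ≤ n → e ∈ hat
    hat-∈⁺ {e} l u = ∈-deduplicate⁺ _≟_ (go (covers l u))
      where
      go : T (keep e) ⊎ T (keep (X e)) → e ∈ blocks keep g h (range n)
      go (inj₁ t) = ∈-blocks⁺ (∈-range⁺ l u) t
        ([ (λ (p , _) → inj₁ (sym p)) , (λ (_ , q) → inj₂ (sym q)) ]′ (values l u))
      go (inj₂ t) = ∈-blocks⁺ (∈-range⁺ (X-positive l u) (X-≤ l u)) t
        ([ (λ (_ , q) → inj₂ (sym (trans q (xx e)))) , (λ (p , _) → inj₁ (sym (trans p (xx e)))) ]′
          (values (X-positive l u) (X-≤ l u)))

    hat-∈⁻ : ∀ {e} → e ∈ hat → 1 ≤ e × e ≤ n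
    hat-∈⁻ {e} e∈ with ∈-blocks⁻ (range n) (∈-deduplicate⁻ _≟_ (blocks keep g h (range n)) e∈)
    ... | a , a∈ , _ , o with ∈-range⁻ a∈
    ...   | l , u with values l u | o
    ...     | inj₁ (p , q) | inj₁ refl = subst (λ z → 1 ≤ z × z ≤ n) (sym p) (l , u)
    ...     | inj₁ (p , q) | inj₂ refl = subst (λ z → 1 ≤ z × z ≤ n) (sym q) (X-bounds l u)
    ...     | inj₂ (p , q) | inj₁ refl = subst (λ z → 1 ≤ z × z ≤ n) (sym p) (X-bounds l u)
    ...     | inj₂ (p , q) | inj₂ refl = subst (λ z → 1 ≤ z × z ≤ n) (sym q) (l , u)

    hat-perm : IsPerm n hat
    hat-perm = unique∧set⇒perm (deduplicate-! (blocks keep g h (range n)))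
      (mk⇔ hat-∈⁻ (λ (l , u) → hat-∈⁺ l u))

    module H = Perm hat-perm

    q : ℕ → ℕ
    q = ⟦ inv n hat ⟧

    q-< : ∀ {a y z} → 1 ≤ a → a ≤ n → T (keep a) → 1 ≤ y → y ≤ n → 1 ≤ z → z ≤ n →
      (∀ {b} → b < a → T (keep b) → h b ≢ z × g b ≢ z) →
      (∀ s → Precedes y z (h a ∷ g a ∷ s)) → q y < q z
    q-< la ua t ly uy lz uz H P = subst₂ _<_ (sym (H.⟦inv⟧≡pos ly uy)) (sym (H.⟦inv⟧≡pos lz uz))
      (precedes⇒pos<
        (precedes-dedup (precedes-blocks (range-increasing n) (∈-range⁺ la ua) t H P))
        (hat-∈⁺ lz uz))

    q-outside : ∀ {a} → n < a → q a ≡ a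
    q-outside = H.⟦inv⟧≡id

    q-zero : q 0 ≡ 0
    q-zero = ⟦⟧-zero (inv n hat)

    q-≤ : ∀ {a} → a ≤ n → q a ≤ n
    q-≤ = ⟦⟧-≤ H.inv-perm

    q-positive : ∀ {a} → 1 ≤ a → a ≤ n → 1 ≤ q a
    q-positive l u = subst (1 ≤_) (sym (H.⟦inv⟧≡pos l u)) (pos-positive (hat-∈⁺ l u))

  at≡ : ∀ {a} → a ≤ n → at x a ≡ X a
  at≡ u = sym (⟦⟧≡at u)

  lower-covers : ∀ {a} → 1 ≤ a → a ≤ n → T (a ≤ᵇ at x a) ⊎ T (X a ≤ᵇ at x (X a))
  lower-covers {a} l u rewrite at≡ u | at≡ (X-≤ l u) | xx a with ≤-total a (X a)
  ... | inj₁ le = inj₁ (≤⇒≤ᵇ le)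
  ... | inj₂ ge = inj₂ (≤⇒≤ᵇ ge)

  upper-covers : ∀ {a} → 1 ≤ a → a ≤ n → T (at x a ≤ᵇ a) ⊎ T (at x (X a) ≤ᵇ X a)
  upper-covers {a} l u rewrite at≡ u | at≡ (X-≤ l u) | xx a with ≤-total (X a) a
  ... | inj₁ le = inj₁ (≤⇒≤ᵇ le)
  ... | inj₂ ge = inj₂ (≤⇒≤ᵇ ge)

  module Lower = Hat (λ a → a ≤ᵇ at x a) id (at x) (λ _ u → inj₂ (at≡ u , refl)) lower-covers
  module Upper = Hat (λ a → at x a ≤ᵇ a) (at x) id (λ _ u → inj₁ (refl , at≡ u)) upper-covers

  hat0-sorted : SortedByLower X ⟦ inv n (hat0 n x) ⟧
  hat0-sorted = record { upperFirst = up ; ordered = ord }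
    where
    open Lower
    keep≤ : ∀ {b} → b ≤ n → b ≤ X b → T (b ≤ᵇ at x b)
    keep≤ {b} u le = ≤⇒≤ᵇ (subst (b ≤_) (sym (at≡ u)) le)

    up : UpperFirst X q
    up {a} lt = q-< l u (keep≤ u (<⇒≤ lt)) (X-positive l u) (X-≤ l u) l u
      -- An earlier block containing a would belong to some b with X b = a, hence to `X a`, which is
      -- larger than a.
      (λ {b} b<a t → (λ e → <-asym b<a (<-≤-trans lt
          (subst (_≤ b) (sym (X-sym (trans (sym (at≡ (<⇒≤ (<-≤-trans b<a u)))) e))) ≤-refl)))
        , <⇒≢ b<a)
      (λ s → subst (λ z → Precedes (X a) a (z ∷ a ∷ s)) (sym (at≡ u)) (here (<⇒≢ lt ∘ sym)))
      where
      in-range = inside-of-moved (<⇒≢ lt)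
      l = proj₁ in-range
      u = proj₂ in-range

    ord : ∀ {a b} → a ≤ X a → b ≤ X b → a < b → q a < q (X b)
    ord {a} {b} la lb a<b with locate n b | locate n a
    -- The conditions range over ℕ, so 0 and the values beyond n, all fixed, are compared as well.
    ... | outside m | zero rewrite q-zero | ⟦⟧≡id m | q-outside m = a<b
    ... | outside m | inside l u rewrite ⟦⟧≡id m | q-outside m = ≤-<-trans (q-≤ u) m
    ... | outside m | outside m′ rewrite ⟦⟧≡id m | q-outside m | q-outside m′ = a<b
    ... | inside l u | zero rewrite q-zero = q-positive (X-positive l u) (X-≤ l u)
    ... | inside l u | outside m = ⊥-elim (<-irrefl refl (<-≤-trans (<-trans m a<b) u))
    ... | inside l u | inside l′ u′ = q-< l′ u′ (keep≤ u′ la) l′ u′ (X-positive l u) (X-≤ l u)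
      -- The value `X b` is in no earlier block: X c = X b gives c = b, and c = X b is too large.
      (λ {c} c<a t → (λ e → <⇒≢ (<-trans c<a a<b) (Xinj (trans (sym (at≡ (<⇒≤ (<-≤-trans c<a u′)))) e)))
        , <⇒≢ (<-trans c<a (<-≤-trans a<b lb)))
      (λ s → there (λ e → <⇒≢ a<b (Xinj (trans (sym (at≡ u′)) e))) (here (<⇒≢ (<-≤-trans a<b lb))))
      where
      Xinj : ∀ {a b} → X a ≡ X b → a ≡ b
      Xinj = involutive⇒injective xx

  hat1-sorted : SortedByUpper X ⟦ inv n (hat1 n x) ⟧
  hat1-sorted = record { upperFirst = up ; ordered = ord }
    where
    open Upper
    keep≥ : ∀ {b} → b ≤ n → X b ≤ b → T (at x b ≤ᵇ b)
    keep≥ {b} u le = ≤⇒≤ᵇ (subst (_≤ b) (sym (at≡ u)) le)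

    up : UpperFirst X q
    up {a} lt = q-< lX uX (keep≥ uX (subst (_≤ X a) (sym (xx a)) (<⇒≤ lt))) lX uX l u
      -- An earlier block containing a would be kept at a, which needs X a ≤ a, or at `X a`, which
      -- is not earlier.
      (λ {b} b<Xa t →
        (λ e → <⇒≱ lt (subst₂ _≤_ (trans (at≡ (<⇒≤ (<-≤-trans b<Xa uX))) (cong X e)) e (≤ᵇ⇒≤ _ _ t)))
        , (λ e → <⇒≢ b<Xa (sym (X-sym (trans (sym (at≡ (<⇒≤ (<-≤-trans b<Xa uX)))) e)))))
      (λ s → here (<⇒≢ lt ∘ sym))
      where
      in-range = inside-of-moved (<⇒≢ lt)
      l = proj₁ in-range
      u = proj₂ in-range
      lX = X-positive l u
      uX = X-≤ l u

    ord : ∀ {a b} → X a ≤ a → X b ≤ b → a < b → q (X a) < q b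
    ord {a} {b} ga gb a<b with locate n b | locate n a
    ... | outside m | zero rewrite ⟦⟧-zero x | q-zero | q-outside m = a<b
    ... | outside m | inside l u rewrite q-outside m = ≤-<-trans (q-≤ (X-≤ l u)) m
    ... | outside m | outside m′ rewrite ⟦⟧≡id m′ | q-outside m | q-outside m′ = a<b
    ... | inside l u | zero rewrite ⟦⟧-zero x | q-zero = q-positive l u
    ... | inside l u | outside m = ⊥-elim (<-irrefl refl (<-≤-trans (<-trans m a<b) u))
    ... | inside l u | inside l′ u′ = q-< l′ u′ (keep≥ u′ ga) (X-positive l′ u′) (X-≤ l′ u′) l u
      (λ {c} c<a t → <⇒≢ (<-trans c<a a<b) , <⇒≢ (≤-<-trans (≤ᵇ⇒≤ _ _ t) (<-trans c<a a<b)))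
      (λ s → there (<⇒≢ a<b) (subst (λ z → Precedes (X a) b (z ∷ s)) (sym (at≡ u′)) (here (<⇒≢ (≤-<-trans ga a<b)))))

-- Comparison of A(x)⁻¹ with the intervals of ≺A

⟦⟧-involutive : ∀ {n x} → IsInvolution n x → Involutive ⟦ x ⟧
⟦⟧-involutive {n} {x} (p , e) a with locate n a
... | zero rewrite ⟦⟧-zero x = ⟦⟧-zero x
... | outside l rewrite Perm.⟦⟧≡id p l = Perm.⟦⟧≡id p l
... | inside l u = begin
  ⟦ x ⟧ (⟦ x ⟧ a)    ≡⟨ cong ⟦ x ⟧ (⟦⟧≡at u) ⟩
  ⟦ x ⟧ (at x a)     ≡⟨ ⟦⟧≡at (proj₂ (at-bounds l u)) ⟩
  at x (at x a)      ≡⟨ at-map (at-zero x) x a ⟨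
  at (compose x x) a ≡⟨ cong (λ v → at v a) e ⟩
  at (range n) a     ≡⟨ at-range l u ⟩
  a                  ∎
  where
  open ≡-Reasoning
  open Perm p

⪯-∷ : ∀ {u v w} → StepA u v → v ⪯A w → u ⪯A w
⪯-∷ s (inj₁ vw)   = inj₁ (_ ∼⁺⟨ [ s ] ⟩ vw)
⪯-∷ s (inj₂ refl) = inj₁ [ s ]

⪯-∷ʳ : ∀ {u v w} → u ⪯A v → StepA v w → u ⪯A w
⪯-∷ʳ (inj₁ uv)   s = inj₁ (_ ∼⁺⟨ uv ⟩ [ s ])
⪯-∷ʳ (inj₂ refl) s = inj₁ [ s ]

module _ {n : ℕ} {X : ℕ → ℕ} (xx : Involutive X) where

  step-atom : ∀ {u v} → IsPerm n u → StepA u v → Atom X ⟦ inv n u ⟧ → Atom X ⟦ inv n v ⟧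
  step-atom pu (step p r a b c a≤b b≤c) = AtomStep.atom-up p r a≤b b≤c pu xx

  step-atom⁻ : ∀ {u v} → IsPerm n u → StepA u v → Atom X ⟦ inv n v ⟧ → Atom X ⟦ inv n u ⟧
  step-atom⁻ pu (step p r a b c a≤b b≤c) = AtomStep.atom-down p r a≤b b≤c pu xx

step-ℓ : ∀ {n u v} → IsPerm n u → StepA u v → ℓ (inv n u) ≡ ℓ (inv n v)
step-ℓ pu (step p r a b c a≤b b≤c) = AtomStep.ℓ-inv≡ p r a≤b b≤c pu

≺-↭ : ∀ {u v} → u ≺A v → u ↭ v
≺-↭ [ s ]             = step-↭ s
≺-↭ (_ ∼⁺⟨ s ⟩ t) = ↭-trans (≺-↭ s) (≺-↭ t)

≺-invariant : ∀ {n} {P : List ℕ → Set} → (∀ {u v} → IsPerm n u → StepA u v → P u → P v) →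
              ∀ {u v} → IsPerm n u → u ≺A v → P u → P v
≺-invariant f pu [ s ] = f pu s
≺-invariant f pu (_ ∼⁺⟨ s ⟩ t) =
  ≺-invariant f (↭-trans (↭-sym (≺-↭ s)) pu) t ∘ ≺-invariant f pu s

≺-invariant⁻ : ∀ {n} {P : List ℕ → Set} → (∀ {u v} → IsPerm n u → StepA u v → P v → P u) →
               ∀ {u v} → IsPerm n u → u ≺A v → P v → P u
≺-invariant⁻ f pu [ s ] = f pu s
≺-invariant⁻ f pu (_ ∼⁺⟨ s ⟩ t) =
  ≺-invariant⁻ f pu s ∘ ≺-invariant⁻ f (↭-trans (↭-sym (≺-↭ s)) pu) t

module _ {n : ℕ} {u v : List ℕ} (pu : IsPerm n u) (pv : IsPerm n v) where
  private
    module U = Perm pu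
    module V = Perm pv

  same-order⇒≡ : (∀ y z → ⟦ inv n u ⟧ y < ⟦ inv n u ⟧ z → ⟦ inv n v ⟧ y < ⟦ inv n v ⟧ z) →
                 (∀ y z → ⟦ inv n v ⟧ y < ⟦ inv n v ⟧ z → ⟦ inv n u ⟧ y < ⟦ inv n u ⟧ z) → u ≡ v
  same-order⇒≡ f g = ⟦⟧-ext (trans U.len (sym V.len))
    (same-order⇒same-inverse U.inv-left U.inv-right V.inv-left V.inv-right f g)

  module _ {X : ℕ → ℕ} (xx : Involutive X) where

    lower-unique : SortedByLower X ⟦ inv n u ⟧ → SortedByLower X ⟦ inv n v ⟧ → u ≡ v
    lower-unique S S′ = same-order⇒≡ (transfer S S′) (transfer S′ S)
      where
      cover : ∀ y → y ≤ X y ⊎ X y ≤ X (X y)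
      cover y = [ inj₁ , inj₂ ∘ subst (X y ≤_) (sym (xx y)) ]′ (≤-total y (X y))
      transfer : ∀ {q r} → SortedByLower X q → SortedByLower X r → ∀ y z → q y < q z → r y < r z
      transfer {q} {r} S S′ = order-determined {X} {q} {r} xx (λ a → a ≤ X a) cover
        (SortedByLower.upperFirst S) (SortedByLower.upperFirst S′) (lower-before S) (lower-before S′)

    upper-unique : SortedByUpper X ⟦ inv n u ⟧ → SortedByUpper X ⟦ inv n v ⟧ → u ≡ v
    upper-unique S S′ = same-order⇒≡ (transfer S S′) (transfer S′ S)
      where
      cover : ∀ y → X y ≤ y ⊎ X (X y) ≤ X y
      cover y = [ inj₁ , inj₂ ∘ subst (_≤ X y) (sym (xx y)) ]′ (≤-total (X y) y)
      transfer : ∀ {q r} → SortedByUpper X q → SortedByUpper X r → ∀ y z → q y < q z → r y < r z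
      transfer {q} {r} S S′ = order-determined {X} {q} {r} xx (λ a → X a ≤ a) cover
        (SortedByUpper.upperFirst S) (SortedByUpper.upperFirst S′) (upper-before xx S) (upper-before xx S′)

module OfInvolution {n x} (invol : IsInvolution n x) where

  xx : Involutive ⟦ x ⟧
  xx = ⟦⟧-involutive invol

  open Hats (proj₁ invol) xx using (hat0-sorted; hat1-sorted; module Lower; module Upper)

  IsAtom : List ℕ → Set
  IsAtom u = Atom ⟦ x ⟧ ⟦ inv n u ⟧

  hat0-perm : IsPerm n (hat0 n x)
  hat0-perm = Lower.hat-perm

  hat1-perm : IsPerm n (hat1 n x)
  hat1-perm = Upper.hat-perm

  -- Undoing steps lowers `suffixWeight` and preserves atoms. It ends at an atom without b c a,
  -- whose cycles are sorted by minimum, and that determines the word.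
  atom-above-hat0 : ∀ {u} → Acc _<_ (suffixWeight u) → IsPerm n u → IsAtom u → hat0 n x ⪯A u
  atom-above-hat0 {u} (acc rs) pu A with step-before pu
  ... | inj₁ (v , s , lt) = ⪯-∷ʳ (atom-above-hat0 (rs lt) pv (step-atom⁻ xx pv s A)) s
    where
    pv : IsPerm n v
    pv = ↭-trans (step-↭ s) pu
  ... | inj₂ none = inj₂ (lower-unique hat0-perm pu xx hat0-sorted
        (Extremal.noBCA⇒sorted xx (Perm.inv-left pu) (Perm.inv-right pu) A none))

  atom-below-hat1 : ∀ {u} → Acc _<_ (prefixWeight u) → IsPerm n u → IsAtom u → u ⪯A hat1 n x
  atom-below-hat1 {u} (acc rs) pu A with step-after pu
  ... | inj₁ (v , s , lt) = ⪯-∷ s (atom-below-hat1 (rs lt) (↭-trans (↭-sym (step-↭ s)) pu) (step-atom xx pu s A))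
  ... | inj₂ none = inj₂ (upper-unique pu hat1-perm xx
        (Extremal.noCAB⇒sorted xx (Perm.inv-left pu) (Perm.inv-right pu) A none) hat1-sorted)

  atom⇔above-hat0 : ∀ {u} → IsPerm n u → IsAtom u ⇔ hat0 n x ⪯A u
  atom⇔above-hat0 {u} pu = mk⇔ (atom-above-hat0 (<-wellFounded _) pu) from
    where
    from : hat0 n x ⪯A u → IsAtom u
    from (inj₁ s)    = ≺-invariant {P = IsAtom} (step-atom xx) hat0-perm s (lower⇒atom xx hat0-sorted)
    from (inj₂ refl) = lower⇒atom xx hat0-sorted

  atom⇔below-hat1 : ∀ {u} → IsPerm n u → IsAtom u ⇔ u ⪯A hat1 n x
  atom⇔below-hat1 {u} pu = mk⇔ (atom-below-hat1 (<-wellFounded _) pu) from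
    where
    from : u ⪯A hat1 n x → IsAtom u
    from (inj₁ s)    = ≺-invariant⁻ {P = IsAtom} (step-atom⁻ xx) pu s (upper⇒atom xx hat1-sorted)
    from (inj₂ refl) = upper⇒atom xx hat1-sorted

  -- Every atom is reached from 0̂(x) by steps that preserve length. This common length replaces any
  -- direct lower bound.
  ℓ-atom : ∀ {u} → IsPerm n u → IsAtom u → ℓ (inv n u) ≡ ℓ (inv n (hat0 n x))
  ℓ-atom {u} pu A with Equivalence.to (atom⇔above-hat0 pu) A
  ... | inj₂ refl = refl
  ... | inj₁ s = ≺-invariant {P = λ v → ℓ (inv n v) ≡ ℓ (inv n (hat0 n x))}
                   (λ pv s e → trans (sym (step-ℓ pv s)) e) hat0-perm s refl

  ℓ-atom-inv : ∀ {w} → IsPerm n w → Atom ⟦ x ⟧ ⟦ w ⟧ → ℓ w ≡ ℓ (inv n (hat0 n x))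
  ℓ-atom-inv {w} pw A = trans (cong ℓ (sym (inv-involutive pw)))
    (ℓ-atom (Perm.inv-perm pw) (subst (λ v → Atom ⟦ x ⟧ ⟦ v ⟧) (sym (inv-involutive pw)) A))

  square≡ : ∀ {w} → IsPerm n w → Atom ⟦ x ⟧ ⟦ w ⟧ → inv n w ○ w ≡ x
  square≡ {w} pw A = trans (sym (square-def n w))
    (⟦⟧-ext (trans (Perm.len (square-perm pw)) (sym (Perm.len (proj₁ invol))))
      (atom⇒square (sorting (ℓ w) refl pw) xx A))

  shorter-atom : ∀ {w} → IsPerm n w → inv n w ○ w ≡ x →
                 ∃ λ v → IsPerm n v × Atom ⟦ x ⟧ ⟦ v ⟧ × (v ≡ w ⊎ ℓ v < ℓ w)
  shorter-atom {w} pw e = subst (λ y → ∃ λ v → IsPerm n v × Atom ⟦ y ⟧ ⟦ v ⟧ × (v ≡ w ⊎ ℓ v < ℓ w))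
    (trans (square-def n w) e) (atom-square (sorting (ℓ w) refl pw))

  -- A minimal w cannot be longer than the atom produced from it, so it is that atom. Conversely,
  -- each competitor yields an atom that is no longer than itself, and all atoms have the same
  -- length.
  InAinv⇔atom : ∀ {u} → IsPerm n u → InAinv n x u ⇔ IsAtom u
  InAinv⇔atom {u} pu = mk⇔ to from
    where
    to : InAinv n x u → IsAtom u
    to (w , (pw , e , minimal) , refl) with shorter-atom pw e
    ... | v , pv , A , inj₁ refl = subst (λ t → Atom ⟦ x ⟧ ⟦ t ⟧) (sym (inv-involutive pw)) A
    ... | v , pv , A , inj₂ lt   = ⊥-elim (<⇒≱ lt (minimal v pv (square≡ pv A)))

    from : IsAtom u → InAinv n x u
    from A = inv n u , (pw , square≡ pw A , minimal) , sym (inv-involutive pu)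
      where
      pw = Perm.inv-perm pu
      minimal : ∀ w′ → IsPerm n w′ → inv n w′ ○ w′ ≡ x → ℓ (inv n u) ≤ ℓ w′
      minimal w′ pw′ e with shorter-atom pw′ e
      ... | v , pv , A′ , o = subst (_≤ ℓ w′) (trans (ℓ-atom-inv pv A′) (sym (ℓ-atom pu A)))
              ([ (λ { refl → ≤-refl }) , <⇒≤ ]′ o)

theorem6p11 : (n : ℕ) (x : List ℕ) → IsInvolution n x →
    (u : List ℕ) → IsPerm n u →
    (InAinv n x u ⇔ hat0 n x ⪯A u) × (InAinv n x u ⇔ u ⪯A hat1 n x)
theorem6p11 n x invol u pu =
  atom⇔above-hat0 pu ⇔-∘ InAinv⇔atom pu , atom⇔below-hat1 pu ⇔-∘ InAinv⇔atom pu
  where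
  open OfInvolution invol
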